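{- Let $p$ be a prime, $f\ge 1$, $q=p^f$, let $k\mid q-1$, and let $A_k=\{x^k : x\in\mathbb{F}_q^\times\}$ be a proper subgroup of $\mathbb{F}_q^\times$ (i.e. $A_k\neq\mathbb{F}_q^\times$) such that $\mathbb{F}_p(A_k)=\mathbb{F}_q$. Then $A_k$, regarded as a subset of the additive group of $\mathbb{F}_q$, is a generalized arithmetic progression (GAP) if and only if $|A_k|\in\{1,2,4\}$.
   Context: For $k\mid q-1$, $A_k$ is the unique subgroup of index $k$ in the cyclic group $\mathbb{F}_q^\times$; every subgroup has this form. $\mathbb{F}_p(A_k)$ denotes the smallest subfield of $\mathbb{F}_q$ containing $A_k$. For $r\ge1$, a rank-$r$ generalized arithmetic progression (GAP) in an abelian group is a set $P=a+[0,L_1-1]d_1+\cdots+[0,L_r-1]d_r=\{a+n_1d_1+\cdots+n_rd_r : n_i\in\mathbb{Z},\ 0\le n_i\le L_i-1\}$, where $L_i\ge 2$ are integers and each $d_i\neq 0$; the parametrization is not required to be injective. A singleton is a rank-zero GAP. A GAP is a GAP of some rank $r\ge0$. -}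

module Defs where

open import Algebra.Bundles using (AbelianGroup; CommutativeRing)
import Algebra.Properties.Monoid.Mult as Mult
import Algebra.Properties.Monoid.Sum as Sum
import Algebra.Properties.Semiring.Exp as Exp
open import Data.Fin.Base using (Fin; toℕ)
open import Data.Nat.Base using (ℕ; _≤_)
open import Data.Product.Base using (Σ; _×_; proj₁; ∃-syntax)
open import Data.Vec.Functional using (Vector)
open import Function.Bundles using (Inverse)
open import Level using (Level; _⊔_)
open import Relation.Binary.Bundles using (Setoid)
import Relation.Binary.Construct.On as On
import Relation.Binary.PropositionalEquality.Properties as ≡
open import Relation.Nullary.Negation.Core using (¬_)
open import Relation.Unary using (Pred; _∈_; _⊆_; _≐_)

private
  variable
    c ℓ a s : Level

-- The number of equivalence classes is what is counted.
HasCardinality : Setoid c ℓ → ℕ → Set (c ⊔ ℓ)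
HasCardinality S n = Inverse S (≡.setoid (Fin n))

subsetoid : (S : Setoid c ℓ) → Pred (Setoid.Carrier S) a → Setoid (c ⊔ a) ℓ
subsetoid S A = On.setoid {B = Σ (Setoid.Carrier S) A} S proj₁

module _ (G : AbelianGroup c ℓ) where

  open AbelianGroup G
    using (Carrier; _≈_; monoid) renaming (_∙_ to _+_; ε to 0#)
  open Mult monoid using () renaming (_×_ to _·_)
  open Sum monoid using (sum)

  -- Two parameter choices may give the same point. For r = 0 the sum is
  -- empty and this is the singleton of a.
  Progression : ∀ {r} → Carrier → Vector ℕ r → Vector Carrier r → Pred Carrier ℓ
  Progression {r} a L d x =
    Σ ((i : Fin r) → Fin (L i)) λ n → x ≈ a + sum (λ i → toℕ (n i) · d i)

  IsGAP : Pred Carrier s → Set (c ⊔ ℓ ⊔ s)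
  IsGAP P =
    ∃[ r ] Σ Carrier λ a → Σ (Vector ℕ r) λ L → Σ (Vector Carrier r) λ d →
      (∀ i → 2 ≤ L i) × (∀ i → ¬ (d i ≈ 0#)) × (P ≐ Progression a L d)

module _ (F : CommutativeRing c ℓ) where

  open CommutativeRing F
    using (Carrier; _≈_; _+_; _*_; -_; 0#; 1#; semiring)
  open Exp semiring using (_^_)

  -- Equality is decidable on a finite setoid, so an apartness relation is
  -- not needed here.
  record IsField : Set (c ⊔ ℓ) where
    field
      1≉0     : ¬ (1# ≈ 0#)
      inverse : ∀ x → ¬ (x ≈ 0#) → ∃[ y ] x * y ≈ 1#

  NonZeroElements : Pred Carrier ℓ
  NonZeroElements x = ¬ (x ≈ 0#)

  PowerSubgroup : ℕ → Pred Carrier (c ⊔ ℓ)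
  PowerSubgroup k y = ∃[ x ] x ∈ NonZeroElements × y ≈ x ^ k

  record IsSubfield (S : Pred Carrier s) : Set (c ⊔ ℓ ⊔ s) where
    field
      resp    : ∀ {x y} → x ≈ y → x ∈ S → y ∈ S
      0∈      : 0# ∈ S
      1∈      : 1# ∈ S
      +-clo   : ∀ {x y} → x ∈ S → y ∈ S → x + y ∈ S
      neg-clo : ∀ {x} → x ∈ S → - x ∈ S
      *-clo   : ∀ {x y} → x ∈ S → y ∈ S → x * y ∈ S
      inv-clo : ∀ {x y} → x ∈ S → x * y ≈ 1# → y ∈ S

  -- The smallest subfield containing A. It is generated inductively because
  -- an intersection of all subfields would range over one universe level
  -- only; that it is smallest among subfields of every level is proved below.
  data Generated (A : Pred Carrier a) : Pred Carrier (c ⊔ ℓ ⊔ a) where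
    gen  : ∀ {x} → x ∈ A → x ∈ Generated A
    resp : ∀ {x y} → x ≈ y → x ∈ Generated A → y ∈ Generated A
    zero : 0# ∈ Generated A
    one  : 1# ∈ Generated A
    add  : ∀ {x y} → x ∈ Generated A → y ∈ Generated A → x + y ∈ Generated A
    neg  : ∀ {x} → x ∈ Generated A → - x ∈ Generated A
    mul  : ∀ {x y} → x ∈ Generated A → y ∈ Generated A → x * y ∈ Generated A
    inv  : ∀ {x y} → x ∈ Generated A → x * y ≈ 1# → y ∈ Generated A

  generated-isSubfield : (A : Pred Carrier a) → IsSubfield (Generated A)
  generated-isSubfield A = record
    { resp = resp ; 0∈ = zero ; 1∈ = one ; +-clo = add ; neg-clo = neg
    ; *-clo = mul ; inv-clo = inv }

  generated-least : {A : Pred Carrier a} {S : Pred Carrier s} →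
                    IsSubfield S → A ⊆ S → Generated A ⊆ S
  generated-least {A = A} {S} isSubfield A⊆S = go
    where
    module S = IsSubfield isSubfield
    go : Generated A ⊆ S
    go (gen x∈A)     = A⊆S x∈A
    go (resp x≈y x∈) = S.resp x≈y (go x∈)
    go zero          = S.0∈
    go one           = S.1∈
    go (add x∈ y∈)   = S.+-clo (go x∈) (go y∈)
    go (neg x∈)      = S.neg-clo (go x∈)
    go (mul x∈ y∈)   = S.*-clo (go x∈) (go y∈)
    go (inv x∈ xy≈1) = S.inv-clo (go x∈) xy≈1

{-# OPTIONS --safe #-}
module Submission where

-- Let A be the group of n-th roots of unity. If A is a progression of positive rank with first
-- difference d, then every x in A has x + d or x − d in A, so E(x) = ((x + d)ⁿ − 1)((x − d)ⁿ − 1)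
-- vanishes on A. Since E(x) = (x² − d²)ⁿ − (x + d)ⁿ − (x − d)ⁿ + 1 on A, reducing modulo xⁿ − 1
-- turns this into identities between binomial coefficients. For odd n they force n = 1. For even
-- n = 2h they read u cᵢ + cₕ₋ᵢ = 2 (n choose 2i) with u = dⁿ and cᵢ = (−1)ⁱ (n choose i); for h ≥ 3
-- the cases i ≤ 2 already give n + 1 = 0 in the field. Then n + 1 = pᵛ m with p ∤ m, and the
-- same computation in y = x^(pᵛ) forces m = 1. Hence A ∪ {0} is the fixed field of x ↦ x^(pᵛ),
-- so A generates the whole field only if A contains all its nonzero elements.

open import Defs
open import Algebra.Bundles using (CommutativeMonoid; CommutativeRing)
import Algebra.Properties.CommutativeMonoid.Mult as CommutativeMonoidMult
import Algebra.Properties.CommutativeMonoid.Sum as Sum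
import Algebra.Properties.CommutativeSemiring.Binomial as Binomial
import Algebra.Properties.CommutativeSemiring.Exp as Exp
import Algebra.Properties.Ring as RingProperties
import Algebra.Properties.Semiring.Mult as Mult
import Algebra.Properties.Semiring.Mult.TCOptimised as TCMult
import Algebra.Solver.Ring as RingSolver
open import Algebra.Solver.Ring.AlmostCommutativeRing using (fromCommutativeRing; _-Raw-AlmostCommutative⟶_)
open import Data.Fin.Base using (Fin; zero; suc; toℕ; fromℕ<; inject≤)
import Data.Fin.Permutation as Perm
import Data.Fin.Properties as Fin
open import Data.Integer.Base as ℤ using (ℤ; -[1+_]; _⊖_)
import Data.Integer.Properties as ℤ
open import Data.List.Base using ([]; _∷_)
open import Data.List.Membership.Propositional using (_∈_)
open import Data.List.Relation.Unary.Any using (here; there)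
open import Data.Maybe.Base using (Maybe; just; nothing)
open import Data.Nat.Base as ℕ using (ℕ; zero; suc; _<_; _≤_; _∸_; z≤n; s≤s)
open import Data.Nat.Combinatorics using (_C_; nCk+nC[k+1]≡[n+1]C[k+1]; nCk≡nC[n∸k]; nCn≡1; nC1≡n)
open import Data.Nat.Coprimality using (Coprime; coprime-Bézout)
open import Data.Nat.Divisibility using (_∣_; _∣?_; divides; ∣⇒≤)
open import Data.Nat.GCD using (module Bézout)
import Data.Nat.Induction as ℕ
open import Data.Nat.Primality using (Prime; prime⇒nonTrivial; prime⇒nonZero; prime⇒irreducible; euclidsLemma)
import Data.Nat.Properties as ℕ
import Data.Nat.Solver
open import Data.Product.Base using (Σ; _×_; _,_; ∃-syntax; proj₁; proj₂)
open import Data.Sum.Base as ⊎ using (_⊎_; inj₁; inj₂; [_,_]′)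
open import Data.Unit.Base using (⊤)
open import Function.Base using (_∘_)
open import Function.Bundles using (_⇔_; mk⇔; Inverse)
open import Induction.WellFounded using (Acc; acc)
open import Level using (_⊔_)
open import Relation.Binary.Bundles using (Setoid)
open import Relation.Binary.Definitions using (Decidable; _Respects_)
open import Relation.Binary.PropositionalEquality as ≡ using (_≡_)
import Relation.Binary.Reasoning.Setoid as SetoidReasoning
open import Relation.Nullary using (Dec; yes; no; ¬_; contradiction; ¬?; _×-dec_)
import Relation.Nullary.Decidable as Dec
open import Relation.Unary as U using (Pred; _≐_)

open Data.Nat.Solver.+-*-Solver using ()
  renaming (solve to solveℕ; _:+_ to _⊕_; _:*_ to _⊛_; con to conℕ; _:=_ to _⊜_)

-- The neighbour condition looks at a single direction of the progression, and it cannot by itself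
-- exclude n + 1 = pᵛ: if `A` together with 0 is a subfield of odd order, then every d in `A`
-- satisfies it, because x + d and x - d are not both 0. The computation therefore has to leave this
-- family standing, and only the hypothesis that `A` generates the field removes it. The orders 2
-- and 4 survive because their identities are consistent. For h = 1 they say u = 4 and for h = 2
-- they say u = -4; these are the n-th powers of -2 and of ±i - 1, the differences of the
-- progressions exhibited below. From h = 3 on the index i = 2 is available as well, and the single
-- unknown u is overdetermined unless n + 1 = 0.

nC0≡1 : ∀ n → n C 0 ≡ 1
nC0≡1 n = ≡.trans (nCk≡nC[n∸k] {0} {n} z≤n) (nCn≡1 n)

-- Free of division, so that it can be read in a field of any characteristic. It yields `2C₂`, the
-- ratio of consecutive binomial coefficients, and the divisibility of `p C k` by `p`.
absorption : ∀ n k → suc k ℕ.* (suc n C suc k) ≡ suc n ℕ.* (n C k)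
absorption zero    zero    = ≡.refl
absorption zero    (suc k) = ℕ.*-zeroʳ (suc (suc k))
absorption (suc n) zero    = begin
  1 ℕ.* (suc (suc n) C 1)       ≡⟨ ≡.cong (1 ℕ.*_) (nC1≡n (suc (suc n))) ⟩
  1 ℕ.* suc (suc n)             ≡⟨ ℕ.*-comm 1 (suc (suc n)) ⟩
  suc (suc n) ℕ.* 1             ≡⟨ ≡.cong (suc (suc n) ℕ.*_) (nC0≡1 (suc n)) ⟨
  suc (suc n) ℕ.* (suc n C 0)   ∎
  where open ≡.≡-Reasoning
absorption (suc n) (suc k) = begin
  suc (suc k) ℕ.* (suc (suc n) C suc (suc k))
    ≡⟨ ≡.cong (suc (suc k) ℕ.*_) (nCk+nC[k+1]≡[n+1]C[k+1] (suc n) (suc k)) ⟨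
  suc (suc k) ℕ.* (c₁ ℕ.+ c₂)
    ≡⟨ solveℕ 3 (λ k a b → (conℕ 2 ⊕ k) ⊛ (a ⊕ b) ⊜ a ⊕ ((conℕ 1 ⊕ k) ⊛ a ⊕ (conℕ 2 ⊕ k) ⊛ b)) ≡.refl k c₁ c₂ ⟩
  c₁ ℕ.+ (suc k ℕ.* c₁ ℕ.+ suc (suc k) ℕ.* c₂)
    ≡⟨ ≡.cong (c₁ ℕ.+_) (≡.cong₂ ℕ._+_ (absorption n k) (absorption n (suc k))) ⟩
  c₁ ℕ.+ (suc n ℕ.* (n C k) ℕ.+ suc n ℕ.* (n C suc k))
    ≡⟨ ≡.cong (c₁ ℕ.+_) (ℕ.*-distribˡ-+ (suc n) (n C k) (n C suc k)) ⟨
  c₁ ℕ.+ suc n ℕ.* (n C k ℕ.+ n C suc k)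
    ≡⟨ ≡.cong (λ c → c₁ ℕ.+ suc n ℕ.* c) (nCk+nC[k+1]≡[n+1]C[k+1] n k) ⟩
  suc (suc n) ℕ.* c₁ ∎
  where
  open ≡.≡-Reasoning
  c₁ = suc n C suc k
  c₂ = suc n C suc (suc k)

-- Pascal's rule and absorption give the sum of both neighbours; cancelling one of them leaves the
-- ratio of consecutive coefficients. Writing the upper index as k + j avoids truncated subtraction.
[k+1]C[k+1]≡jCk : ∀ k j → suc k ℕ.* ((k ℕ.+ j) C suc k) ≡ j ℕ.* ((k ℕ.+ j) C k)
[k+1]C[k+1]≡jCk k j = ℕ.+-cancelˡ-≡ (suc k ℕ.* (n C k)) _ _ (begin
  suc k ℕ.* (n C k) ℕ.+ suc k ℕ.* (n C suc k)  ≡⟨ ℕ.*-distribˡ-+ (suc k) (n C k) (n C suc k) ⟨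
  suc k ℕ.* (n C k ℕ.+ n C suc k)              ≡⟨ ≡.cong (suc k ℕ.*_) (nCk+nC[k+1]≡[n+1]C[k+1] n k) ⟩
  suc k ℕ.* (suc n C suc k)                    ≡⟨ absorption n k ⟩
  (suc k ℕ.+ j) ℕ.* (n C k)                    ≡⟨ ℕ.*-distribʳ-+ (n C k) (suc k) j ⟩
  suc k ℕ.* (n C k) ℕ.+ j ℕ.* (n C k)          ∎)
  where
  open ≡.≡-Reasoning
  n = k ℕ.+ j

-- Polynomials over a commutative ring, given by coefficient sequences

module Polynomials {c ℓ} (R : CommutativeRing c ℓ) where

  open CommutativeRing R public renaming (zero to *-zero)
  open Exp commutativeSemiring public
  open RingProperties ring public using (-‿distribˡ-*; -‿distribʳ-*; -‿involutive; -0#≈0#; -‿+-comm)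
  open SetoidReasoning setoid public

  private
    module × = TCMult semiring
    module M = Mult semiring

  -- With this form of the multiple, `ι 1` computes to `1#` and `ι 2` to `1# + 1#`, so small
  -- numerals agree definitionally with the constants of the solver.
  ι : ℕ → Carrier
  ι n = n ×.× 1#

  ι-+ : ∀ m n → ι (m ℕ.+ n) ≈ ι m + ι n
  ι-+ = ×.×-homo-+ 1#

  ι-* : ∀ m n → ι (m ℕ.* n) ≈ ι m * ι n
  ι-* = ×.×1-homo-*

  ι-suc : ∀ n → ι (suc n) ≈ 1# + ι n
  ι-suc n = ×.1+× n 1#

  ι-≡ : ∀ {m n} → m ≡ n → ι m ≈ ι n
  ι-≡ ≡.refl = refl

  ×≈ι* : ∀ n x → n M.× x ≈ ι n * x
  ×≈ι* n x = begin
    n M.× x          ≈⟨ M.×-congʳ n (*-identityˡ x) ⟨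
    n M.× (1# * x)   ≈⟨ M.×-assoc-* n 1# x ⟨
    n M.× 1# * x     ≈⟨ *-congʳ (×.×ᵤ≈× n 1#) ⟩
    ι n * x          ∎

  -- The ring solver cancels terms only over coefficients with decidable equality, hence ℤ.
  ⟦_⟧ℤ : ℤ → Carrier
  ⟦ ℤ.+ n      ⟧ℤ = ι n
  ⟦ -[1+ n ]   ⟧ℤ = - ι (suc n)

  -- Done by hand, since the ring solver is built on top of it.
  cancel-1+ : ∀ x y → (1# + x) - (1# + y) ≈ x - y
  cancel-1+ x y = begin
    (1# + x) + - (1# + y)     ≈⟨ +-cong (+-comm 1# x) (sym (-‿+-comm 1# y)) ⟩
    (x + 1#) + (- 1# + - y)   ≈⟨ +-assoc x 1# _ ⟩
    x + (1# + (- 1# + - y))   ≈⟨ +-congˡ (+-assoc 1# (- 1#) (- y)) ⟨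
    x + ((1# + - 1#) + - y)   ≈⟨ +-congˡ (+-congʳ (-‿inverseʳ 1#)) ⟩
    x + (0# + - y)            ≈⟨ +-congˡ (+-identityˡ (- y)) ⟩
    x + - y                   ∎

  ⟦⟧-⊖ : ∀ m n → ⟦ m ⊖ n ⟧ℤ ≈ ι m - ι n
  ⟦⟧-⊖ m       zero    = sym (trans (+-congˡ -0#≈0#) (+-identityʳ (ι m)))
  ⟦⟧-⊖ zero    (suc n) = sym (+-identityˡ _)
  ⟦⟧-⊖ (suc m) (suc n) = begin
    ⟦ suc m ⊖ suc n ⟧ℤ       ≡⟨ ≡.cong ⟦_⟧ℤ (ℤ.[1+m]⊖[1+n]≡m⊖n m n) ⟩
    ⟦ m ⊖ n ⟧ℤ               ≈⟨ ⟦⟧-⊖ m n ⟩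
    ι m - ι n                ≈⟨ cancel-1+ (ι m) (ι n) ⟨
    (1# + ι m) - (1# + ι n)  ≈⟨ +-cong (ι-suc m) (-‿cong (ι-suc n)) ⟨
    ι (suc m) - ι (suc n)    ∎

  ⟦⟧-+ : ∀ i j → ⟦ i ℤ.+ j ⟧ℤ ≈ ⟦ i ⟧ℤ + ⟦ j ⟧ℤ
  ⟦⟧-+ (ℤ.+ m)      (ℤ.+ n)      = ι-+ m n
  ⟦⟧-+ (ℤ.+ m)      -[1+ n ]   = ⟦⟧-⊖ m (suc n)
  ⟦⟧-+ -[1+ m ]   (ℤ.+ n)      = trans (⟦⟧-⊖ n (suc m)) (+-comm _ _)
  ⟦⟧-+ -[1+ m ]   -[1+ n ]   = begin
    - ι (suc (suc (m ℕ.+ n)))     ≡⟨ ≡.cong (λ k → - ι (suc k)) (ℕ.+-suc m n) ⟨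
    - ι (suc m ℕ.+ suc n)         ≈⟨ -‿cong (ι-+ (suc m) (suc n)) ⟩
    - (ι (suc m) + ι (suc n))     ≈⟨ -‿+-comm _ _ ⟨
    - ι (suc m) + - ι (suc n)     ∎

  ⟦⟧-neg : ∀ i → ⟦ ℤ.- i ⟧ℤ ≈ - ⟦ i ⟧ℤ
  ⟦⟧-neg (ℤ.+ zero)  = sym -0#≈0#
  ⟦⟧-neg (ℤ.+ suc n) = refl
  ⟦⟧-neg -[1+ n ]  = sym (-‿involutive _)

  ⟦⟧-*-pos : ∀ m j → ⟦ ℤ.+ m ℤ.* j ⟧ℤ ≈ ι m * ⟦ j ⟧ℤ
  ⟦⟧-*-pos m (ℤ.+ n)    = begin
    ⟦ ℤ.+ m ℤ.* ℤ.+ n ⟧ℤ    ≡⟨ ≡.cong ⟦_⟧ℤ (ℤ.pos-* m n) ⟨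
    ι (m ℕ.* n)         ≈⟨ ι-* m n ⟩
    ι m * ι n           ∎
  ⟦⟧-*-pos m -[1+ n ] = begin
    ⟦ ℤ.+ m ℤ.* ℤ.- (ℤ.+ suc n) ⟧ℤ   ≡⟨ ≡.cong ⟦_⟧ℤ (ℤ.neg-distribʳ-* (ℤ.+ m) (ℤ.+ suc n)) ⟨
    ⟦ ℤ.- (ℤ.+ m ℤ.* ℤ.+ suc n) ⟧ℤ   ≈⟨ ⟦⟧-neg (ℤ.+ m ℤ.* ℤ.+ suc n) ⟩
    - ⟦ ℤ.+ m ℤ.* ℤ.+ suc n ⟧ℤ       ≈⟨ -‿cong (⟦⟧-*-pos m (ℤ.+ suc n)) ⟩
    - (ι m * ι (suc n))          ≈⟨ -‿distribʳ-* _ _ ⟩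
    ι m * - ι (suc n)            ∎

  ⟦⟧-* : ∀ i j → ⟦ i ℤ.* j ⟧ℤ ≈ ⟦ i ⟧ℤ * ⟦ j ⟧ℤ
  ⟦⟧-* (ℤ.+ m)    j = ⟦⟧-*-pos m j
  ⟦⟧-* -[1+ m ] j = begin
    ⟦ ℤ.- (ℤ.+ suc m) ℤ.* j ⟧ℤ     ≡⟨ ≡.cong ⟦_⟧ℤ (ℤ.neg-distribˡ-* (ℤ.+ suc m) j) ⟨
    ⟦ ℤ.- (ℤ.+ suc m ℤ.* j) ⟧ℤ     ≈⟨ ⟦⟧-neg (ℤ.+ suc m ℤ.* j) ⟩
    - ⟦ ℤ.+ suc m ℤ.* j ⟧ℤ         ≈⟨ -‿cong (⟦⟧-*-pos (suc m) j) ⟩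
    - (ι (suc m) * ⟦ j ⟧ℤ)       ≈⟨ -‿distribˡ-* _ _ ⟩
    - ι (suc m) * ⟦ j ⟧ℤ         ∎

  ℤ⟶R : CommutativeRing.rawRing ℤ.+-*-commutativeRing -Raw-AlmostCommutative⟶ fromCommutativeRing R
  ℤ⟶R = record
    { ⟦_⟧ = ⟦_⟧ℤ ; +-homo = ⟦⟧-+ ; *-homo = ⟦⟧-* ; -‿homo = ⟦⟧-neg ; 0-homo = refl ; 1-homo = refl }

  ⟦_⟧≟⟦_⟧ : ∀ i j → Maybe (⟦ i ⟧ℤ ≈ ⟦ j ⟧ℤ)
  ⟦ i ⟧≟⟦ j ⟧ with i ℤ.≟ j
  ... | yes ≡.refl = just refl
  ... | no  _      = nothing

  open RingSolver (CommutativeRing.rawRing ℤ.+-*-commutativeRing) (fromCommutativeRing R) ℤ⟶R ⟦_⟧≟⟦_⟧ public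
    using (solve; _:=_; _:+_; _:*_; _:-_; :-_; con; Polynomial)

  :0 :1 : ∀ {n} → Polynomial n
  :0 = con (ℤ.+ 0)
  :1 = con (ℤ.+ 1)

  -- Horner evaluation of the first n coefficients. The sequence itself is infinite and is cut only
  -- here, so shifts and linear combinations need no bookkeeping of lengths.
  ev : ℕ → (ℕ → Carrier) → Carrier → Carrier
  ev zero    a x = 0#
  ev (suc n) a x = a 0 + x * ev n (a ∘ suc) x

  ev-zero : ∀ n {a : ℕ → Carrier} {x} → (∀ i → i < n → a i ≈ 0#) → ev n a x ≈ 0#
  ev-zero zero        a≈0 = refl
  ev-zero (suc n) {a} {x} a≈0 = begin
    a 0 + x * ev n (a ∘ suc) x   ≈⟨ +-cong (a≈0 0 (s≤s z≤n)) (*-congˡ (ev-zero n (λ i i<n → a≈0 (suc i) (s≤s i<n)))) ⟩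
    0# + x * 0#                  ≈⟨ +-identityˡ _ ⟩
    x * 0#                       ≈⟨ zeroʳ x ⟩
    0#                           ∎

  ev-linear : ∀ n (a b : ℕ → Carrier) s t x → s * ev n a x + t * ev n b x ≈ ev n (λ i → s * a i + t * b i) x
  ev-linear zero    a b s t x = solve 2 (λ s t → s :* :0 :+ t :* :0 := :0) refl s t
  ev-linear (suc n) a b s t x = begin
    s * (a 0 + x * A) + t * (b 0 + x * B)
      ≈⟨ solve 7 (λ s t a b x A B → s :* (a :+ x :* A) :+ t :* (b :+ x :* B)
                                 := (s :* a :+ t :* b) :+ x :* (s :* A :+ t :* B)) refl s t (a 0) (b 0) x A B ⟩
    (s * a 0 + t * b 0) + x * (s * A + t * B)
      ≈⟨ +-congˡ (*-congˡ (ev-linear n (a ∘ suc) (b ∘ suc) s t x)) ⟩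
    (s * a 0 + t * b 0) + x * ev n (λ i → s * a (suc i) + t * b (suc i)) x ∎
    where
    A = ev n (a ∘ suc) x
    B = ev n (b ∘ suc) x

  ev-split : ∀ m n (a : ℕ → Carrier) x → ev (m ℕ.+ n) a x ≈ ev m a x + x ^ m * ev n (λ j → a (m ℕ.+ j)) x
  ev-split zero    n a x = sym (trans (+-identityˡ _) (*-identityˡ _))
  ev-split (suc m) n a x = begin
    a 0 + x * ev (m ℕ.+ n) (a ∘ suc) x   ≈⟨ +-congˡ (*-congˡ (ev-split m n (a ∘ suc) x)) ⟩
    a 0 + x * (A + x ^ m * B)
      ≈⟨ solve 5 (λ a x A p B → a :+ x :* (A :+ p :* B) := (a :+ x :* A) :+ (x :* p) :* B) refl (a 0) x A (x ^ m) B ⟩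
    (a 0 + x * A) + x ^ suc m * B ∎
    where
    A = ev m (a ∘ suc) x
    B = ev n (λ j → a (suc m ℕ.+ j)) x

  ev-snoc : ∀ n (a : ℕ → Carrier) x → ev (suc n) a x ≈ ev n a x + x ^ n * a n
  ev-snoc zero    a x = solve 2 (λ a x → a :+ x :* :0 := :0 :+ :1 :* a) refl (a 0) x
  ev-snoc (suc n) a x = begin
    a 0 + x * ev (suc n) (a ∘ suc) x           ≈⟨ +-congˡ (*-congˡ (ev-snoc n (a ∘ suc) x)) ⟩
    a 0 + x * (ev n (a ∘ suc) x + x ^ n * a (suc n))
      ≈⟨ solve 5 (λ a x A p b → a :+ x :* (A :+ p :* b) := (a :+ x :* A) :+ (x :* p) :* b) refl (a 0) x _ (x ^ n) _ ⟩
    (a 0 + x * ev n (a ∘ suc) x) + x ^ suc n * a (suc n) ∎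

  append : ℕ → (ℕ → Carrier) → (ℕ → Carrier) → ℕ → Carrier
  append zero    a b i       = b i
  append (suc m) a b zero    = a 0
  append (suc m) a b (suc i) = append m (a ∘ suc) b i

  append-< : ∀ {m} {a b : ℕ → Carrier} {i} → i < m → append m a b i ≡ a i
  append-< {suc m} {i = zero}  i<m       = ≡.refl
  append-< {suc m} {i = suc i} (s≤s i<m) = append-< {m} i<m

  ev-append : ∀ m n (a b : ℕ → Carrier) x → ev (m ℕ.+ n) (append m a b) x ≈ ev m a x + x ^ m * ev n b x
  ev-append zero    n a b x = sym (trans (+-identityˡ _) (*-identityˡ _))
  ev-append (suc m) n a b x = begin
    a 0 + x * ev (m ℕ.+ n) (append m (a ∘ suc) b) x   ≈⟨ +-congˡ (*-congˡ (ev-append m n (a ∘ suc) b x)) ⟩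
    a 0 + x * (A + x ^ m * B)
      ≈⟨ solve 5 (λ a x A p B → a :+ x :* (A :+ p :* B) := (a :+ x :* A) :+ (x :* p) :* B) refl (a 0) x A (x ^ m) B ⟩
    (a 0 + x * A) + x ^ suc m * B ∎
    where
    A = ev m (a ∘ suc) x
    B = ev n b x

  -- The coefficients of a (x ²).
  dilate : (ℕ → Carrier) → ℕ → Carrier
  dilate a zero          = a 0
  dilate a (suc zero)    = 0#
  dilate a (suc (suc i)) = dilate (a ∘ suc) i

  dilate-even : ∀ (a : ℕ → Carrier) i → dilate a (i ℕ.* 2) ≡ a i
  dilate-even a zero    = ≡.refl
  dilate-even a (suc i) = dilate-even (a ∘ suc) i

  dilate-odd : ∀ (a : ℕ → Carrier) i → dilate a (suc (i ℕ.* 2)) ≡ 0#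
  dilate-odd a zero    = ≡.refl
  dilate-odd a (suc i) = dilate-odd (a ∘ suc) i

  ev-dilate*2 : ∀ n (a : ℕ → Carrier) x → ev (n ℕ.* 2) (dilate a) x ≈ ev n a (x * x)
  ev-dilate*2 zero    a x = refl
  ev-dilate*2 (suc n) a x = begin
    a 0 + x * (0# + x * ev (n ℕ.* 2) (dilate (a ∘ suc)) x)
      ≈⟨ solve 3 (λ a x A → a :+ x :* (:0 :+ x :* A) := a :+ (x :* x) :* A) refl (a 0) x _ ⟩
    a 0 + (x * x) * ev (n ℕ.* 2) (dilate (a ∘ suc)) x
      ≈⟨ +-congˡ (*-congˡ (ev-dilate*2 n (a ∘ suc) x)) ⟩
    a 0 + (x * x) * ev n (a ∘ suc) (x * x) ∎

  n*2≡n+n : ∀ n → n ℕ.* 2 ≡ n ℕ.+ n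
  n*2≡n+n n = ≡.trans (ℕ.*-comm n 2) (≡.cong (n ℕ.+_) (ℕ.+-identityʳ n))

  -- The recursion of `dilate` consumes two indices at a time and wants n * 2; splitting in the
  -- middle by `ev-split` wants n + n.
  ev-dilate : ∀ n (a : ℕ → Carrier) x → ev (n ℕ.+ n) (dilate a) x ≈ ev n a (x * x)
  ev-dilate n a x = trans (reflexive (≡.cong (λ k → ev k (dilate a) x) (≡.sym (n*2≡n+n n)))) (ev-dilate*2 n a x)

  monomial : ℕ → ℕ → Carrier
  monomial zero    zero    = 1#
  monomial zero    (suc i) = 0#
  monomial (suc n) zero    = 0#
  monomial (suc n) (suc i) = monomial n i

  ev-monomial : ∀ {n k} → k < n → ∀ x → ev n (monomial k) x ≈ x ^ k
  ev-monomial {suc n} {zero}  k<n x = begin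
    1# + x * ev n (λ _ → 0#) x   ≈⟨ +-congˡ (*-congˡ (ev-zero n (λ _ _ → refl))) ⟩
    1# + x * 0#                  ≈⟨ solve 1 (λ x → :1 :+ x :* :0 := :1) refl x ⟩
    1#                           ∎
  ev-monomial {suc n} {suc k} (s≤s k<n) x = begin
    0# + x * ev n (monomial k) x   ≈⟨ +-identityˡ _ ⟩
    x * ev n (monomial k) x        ≈⟨ *-congˡ (ev-monomial k<n x) ⟩
    x * x ^ k                      ∎

  -- The coefficient of x ^ j in (x + y) ^ n.
  binomialCoeff : ℕ → Carrier → ℕ → Carrier
  binomialCoeff n y j = ι (n C j) * y ^ (n ∸ j)

  private module ∑ = Sum +-commutativeMonoid

  sum≈ev : ∀ n (a : ℕ → Carrier) x → ∑.sum {n} (λ k → x ^ toℕ k * a (toℕ k)) ≈ ev n a x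
  sum≈ev zero    a x = refl
  sum≈ev (suc n) a x = begin
    1# * a 0 + ∑.sum {n} (λ k → (x * x ^ toℕ k) * a (suc (toℕ k)))
      ≈⟨ +-cong (*-identityˡ (a 0)) (factor n (λ k → x ^ toℕ k) (λ k → a (suc (toℕ k)))) ⟩
    a 0 + x * ∑.sum {n} (λ k → x ^ toℕ k * a (suc (toℕ k)))
      ≈⟨ +-congˡ (*-congˡ (sum≈ev n (a ∘ suc) x)) ⟩
    a 0 + x * ev n (a ∘ suc) x ∎
    where
    factor : ∀ n (f g : Fin n → Carrier) → ∑.sum (λ k → (x * f k) * g k) ≈ x * ∑.sum (λ k → f k * g k)
    factor zero    f g = sym (zeroʳ x)
    factor (suc n) f g = begin
      (x * f zero) * g zero + ∑.sum (λ k → (x * f (suc k)) * g (suc k))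
        ≈⟨ +-cong (*-assoc x _ _) (factor n (f ∘ suc) (g ∘ suc)) ⟩
      x * (f zero * g zero) + x * ∑.sum (λ k → f (suc k) * g (suc k))
        ≈⟨ distribˡ x _ _ ⟨
      x * (f zero * g zero + ∑.sum (λ k → f (suc k) * g (suc k))) ∎

  -- The leading term stands apart from the n lower coefficients, so that x ^ n can be replaced by 1
  -- at a root of unity.
  binomial : ∀ n x y → (x + y) ^ n ≈ ev n (binomialCoeff n y) x + x ^ n
  binomial n x y = begin
    (x + y) ^ n                                              ≈⟨ Binomial.theorem commutativeSemiring n x y ⟩
    Binomial.binomialExpansion commutativeSemiring x y n     ≈⟨ ∑.sum-cong-≋ {suc n} term ⟩
    ∑.sum {suc n} (λ k → x ^ toℕ k * b (toℕ k))              ≈⟨ sum≈ev (suc n) b x ⟩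
    ev (suc n) b x                                           ≈⟨ ev-snoc n b x ⟩
    ev n b x + x ^ n * (ι (n C n) * y ^ (n ∸ n))             ≡⟨ ≡.cong₂ (λ i j → ev n b x + x ^ n * (ι i * y ^ j)) (nCn≡1 n) (ℕ.n∸n≡0 n) ⟩
    ev n b x + x ^ n * (1# * 1#)                             ≈⟨ solve 2 (λ e p → e :+ p :* (:1 :* :1) := e :+ p) refl _ _ ⟩
    ev n b x + x ^ n                                         ∎
    where
    b = binomialCoeff n y
    term : ∀ k → (n C toℕ k) M.× (x ^ toℕ k * y ^ (n ∸ toℕ k)) ≈ x ^ toℕ k * b (toℕ k)
    term k = trans (×≈ι* (n C toℕ k) _)
      (solve 3 (λ c p q → c :* (p :* q) := p :* (c :* q)) refl (ι (n C toℕ k)) (x ^ toℕ k) _)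

  ^-zeroˡ : ∀ n → 0 < n → 0# ^ n ≈ 0#
  ^-zeroˡ (suc n) _ = zeroˡ _

  1^n≈1 : ∀ n → 1# ^ n ≈ 1#
  1^n≈1 zero    = refl
  1^n≈1 (suc n) = trans (*-identityˡ _) (1^n≈1 n)

  -- Even and odd exponents have the forms k * 2 and suc (k * 2) throughout: these unfold by two
  -- factors at each step, and no parity has to be tested.
  [-x]^[k*2] : ∀ x k → (- x) ^ (k ℕ.* 2) ≈ x ^ (k ℕ.* 2)
  [-x]^[k*2] x zero    = refl
  [-x]^[k*2] x (suc k) = trans (*-congˡ (*-congˡ ([-x]^[k*2] x k)))
    (solve 2 (λ x p → (:- x) :* ((:- x) :* p) := x :* (x :* p)) refl x (x ^ (k ℕ.* 2)))

  [-x]^[1+k*2] : ∀ x k → (- x) ^ suc (k ℕ.* 2) ≈ - (x ^ suc (k ℕ.* 2))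
  [-x]^[1+k*2] x k = trans (*-congˡ ([-x]^[k*2] x k)) (sym (-‿distribˡ-* x _))

  -1^ : ℕ → Carrier
  -1^ n = (- 1#) ^ n

  [-x]^n : ∀ x n → (- x) ^ n ≈ -1^ n * x ^ n
  [-x]^n x n = trans (^-congˡ n (solve 1 (λ x → :- x := (:- :1) :* x) refl x)) (^-distrib-* (- 1#) x n)

-- Zeros of polynomials over a field

module FieldProperties {c ℓ} (F : CommutativeRing c ℓ) (isField : IsField F)
  (_≟_ : Decidable (CommutativeRing._≈_ F)) where

  open Polynomials F public
  open IsField isField public

  x-y≈0⇒x≈y : ∀ {x y} → x - y ≈ 0# → x ≈ y
  x-y≈0⇒x≈y {x} {y} x-y≈0 = begin
    x             ≈⟨ solve 2 (λ x y → x := (x :- y) :+ y) refl x y ⟩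
    (x - y) + y   ≈⟨ +-congʳ x-y≈0 ⟩
    0# + y        ≈⟨ +-identityˡ y ⟩
    y             ∎

  x≈y⇒x-y≈0 : ∀ {x y} → x ≈ y → x - y ≈ 0#
  x≈y⇒x-y≈0 {x} {y} x≈y = trans (+-congʳ x≈y) (-‿inverseʳ y)

  xy≈0⇒y≈0 : ∀ {x y} → x * y ≈ 0# → ¬ x ≈ 0# → y ≈ 0#
  xy≈0⇒y≈0 {x} {y} xy≈0 x≉0 with x⁻¹ , xx⁻¹≈1 ← inverse x x≉0 = begin
    y                ≈⟨ *-identityˡ y ⟨
    1# * y           ≈⟨ *-congʳ xx⁻¹≈1 ⟨
    (x * x⁻¹) * y    ≈⟨ solve 3 (λ x z y → (x :* z) :* y := z :* (x :* y)) refl x x⁻¹ y ⟩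
    x⁻¹ * (x * y)    ≈⟨ *-congˡ xy≈0 ⟩
    x⁻¹ * 0#         ≈⟨ zeroʳ x⁻¹ ⟩
    0#               ∎

  xy≈0⇒x≈0⊎y≈0 : ∀ {x y} → x * y ≈ 0# → x ≈ 0# ⊎ y ≈ 0#
  xy≈0⇒x≈0⊎y≈0 {x} xy≈0 with x ≟ 0#
  ... | yes x≈0 = inj₁ x≈0
  ... | no  x≉0 = inj₂ (xy≈0⇒y≈0 xy≈0 x≉0)

  *-cancelʳ : ∀ {x y z} → ¬ z ≈ 0# → x * z ≈ y * z → x ≈ y
  *-cancelʳ {x} {y} {z} z≉0 xz≈yz = x-y≈0⇒x≈y (xy≈0⇒y≈0 (begin
    z * (x - y)      ≈⟨ solve 3 (λ x y z → z :* (x :- y) := x :* z :- y :* z) refl x y z ⟩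
    x * z - y * z    ≈⟨ x≈y⇒x-y≈0 xz≈yz ⟩
    0#               ∎) z≉0)

  *-nonzero : ∀ {x y} → ¬ x ≈ 0# → ¬ y ≈ 0# → ¬ x * y ≈ 0#
  *-nonzero x≉0 y≉0 xy≈0 = y≉0 (xy≈0⇒y≈0 xy≈0 x≉0)

  ^-nonzero : ∀ {x} → ¬ x ≈ 0# → ∀ n → ¬ x ^ n ≈ 0#
  ^-nonzero x≉0 zero    = 1≉0
  ^-nonzero x≉0 (suc n) = *-nonzero x≉0 (^-nonzero x≉0 n)

  x^n≈0⇒x≈0 : ∀ {x} n → x ^ n ≈ 0# → x ≈ 0#
  x^n≈0⇒x≈0 {x} n x^n≈0 with x ≟ 0#
  ... | yes x≈0 = x≈0
  ... | no  x≉0 = contradiction x^n≈0 (^-nonzero x≉0 n)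

  Distinct : ∀ {n} → (Fin n → Carrier) → Set ℓ
  Distinct y = ∀ {i j} → y i ≈ y j → i ≡ j

  -- Synthetic division: the coefficients of (a(x) - a(r)) / (x - r), each of them the value at r of
  -- a tail of `a`.
  quotient : ℕ → (ℕ → Carrier) → Carrier → ℕ → Carrier
  quotient zero    a r i       = 0#
  quotient (suc n) a r zero    = ev (suc n) (a ∘ suc) r
  quotient (suc n) a r (suc i) = quotient n (a ∘ suc) r i

  ev-quotient : ∀ n (a : ℕ → Carrier) r x →
                ev (suc n) a x ≈ ev (suc n) a r + (x - r) * ev n (quotient n a r) x
  ev-quotient zero    a r x =
    solve 3 (λ a r x → a :+ x :* :0 := (a :+ r :* :0) :+ (x :- r) :* :0) refl (a 0) r x
  ev-quotient (suc n) a r x = begin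
    a 0 + x * ev (suc n) (a ∘ suc) x    ≈⟨ +-congˡ (*-congˡ (ev-quotient n (a ∘ suc) r x)) ⟩
    a 0 + x * (E + (x - r) * Q)
      ≈⟨ solve 5 (λ a x r E Q → a :+ x :* (E :+ (x :- r) :* Q) := (a :+ r :* E) :+ (x :- r) :* (E :+ x :* Q))
               refl (a 0) x r E Q ⟩
    (a 0 + r * E) + (x - r) * (E + x * Q) ∎
    where
    E = ev (suc n) (a ∘ suc) r
    Q = ev n (quotient n (a ∘ suc) r) x

  -- The system is triangular from the top: once the higher coefficients vanish, the value at r of a
  -- tail is just its first coefficient.
  quotient≈0 : ∀ n (a : ℕ → Carrier) r → (∀ i → i < n → quotient n a r i ≈ 0#) →
               ∀ i → i < n → a (suc i) ≈ 0#
  quotient≈0 (suc n) a r q≈0 = λ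
    { zero    _         → begin
        a 1                                            ≈⟨ +-identityʳ _ ⟨
        a 1 + 0#                                       ≈⟨ +-congˡ (zeroʳ r) ⟨
        a 1 + r * 0#                                   ≈⟨ +-congˡ (*-congˡ (ev-zero n tail≈0)) ⟨
        a 1 + r * ev n (λ i → a (suc (suc i))) r               ≈⟨ q≈0 0 (s≤s z≤n) ⟩
        0#                                             ∎
    ; (suc i) (s≤s i<n) → tail≈0 i i<n
    }
    where
    tail≈0 : ∀ i → i < n → a (suc (suc i)) ≈ 0#
    tail≈0 = quotient≈0 n (a ∘ suc) r (λ i i<n → q≈0 (suc i) (s≤s i<n))

  -- Induction on the number of zeros. Dividing by x - r for the first zero r leaves a quotient that
  -- vanishes at the others, where the factor x - r is nonzero.
  vanishing⇒coeff≈0 : ∀ n (a : ℕ → Carrier) (y : Fin n → Carrier) → Distinct y →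
                (∀ i → ev n a (y i) ≈ 0#) → ∀ i → i < n → a i ≈ 0#
  vanishing⇒coeff≈0 (suc n) a y y-distinct vanish = coeff
    where
    r = y zero
    q≈0 : ∀ i → i < n → quotient n a r i ≈ 0#
    q≈0 = vanishing⇒coeff≈0 n (quotient n a r) (y ∘ suc) (Fin.suc-injective ∘ y-distinct) λ i →
      xy≈0⇒y≈0 {y (suc i) - r} (begin
        (y (suc i) - r) * ev n (quotient n a r) (y (suc i))                       ≈⟨ +-identityˡ _ ⟨
        0# + (y (suc i) - r) * ev n (quotient n a r) (y (suc i))                  ≈⟨ +-congʳ (vanish zero) ⟨
        ev (suc n) a r + (y (suc i) - r) * ev n (quotient n a r) (y (suc i))      ≈⟨ ev-quotient n a r (y (suc i)) ⟨
        ev (suc n) a (y (suc i))                                                  ≈⟨ vanish (suc i) ⟩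
        0#                                                                        ∎)
      (λ y-r≈0 → contradiction (y-distinct (x-y≈0⇒x≈y y-r≈0)) λ ())
    tail≈0 : ∀ i → i < n → a (suc i) ≈ 0#
    tail≈0 = quotient≈0 n a r q≈0
    coeff : ∀ i → i < suc n → a i ≈ 0#
    coeff zero    _         = begin
      a 0                                ≈⟨ +-identityʳ _ ⟨
      a 0 + 0#                           ≈⟨ +-congˡ (zeroʳ r) ⟨
      a 0 + r * 0#                       ≈⟨ +-congˡ (*-congˡ (ev-zero n tail≈0)) ⟨
      a 0 + r * ev n (a ∘ suc) r         ≈⟨ vanish zero ⟩
      0#                                 ∎
    coeff (suc i) (s≤s i<n) = tail≈0 i i<n

  vanishing⇒coeff≈0-≤ : ∀ {m n} → m ≤ n → (a : ℕ → Carrier) (y : Fin n → Carrier) → Distinct y →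
                (∀ i → ev m a (y i) ≈ 0#) → ∀ i → i < m → a i ≈ 0#
  vanishing⇒coeff≈0-≤ m≤n a y y-distinct vanish = vanishing⇒coeff≈0 _ a (λ i → y (inject≤ i m≤n))
    (Fin.inject≤-injective m≤n m≤n _ _ ∘ y-distinct) (λ i → vanish (inject≤ i m≤n))

  rootsOfUnity-≤ : ∀ {k n} → 0 < k → (y : Fin n → Carrier) → Distinct y → (∀ i → y i ^ k ≈ 1#) → n ≤ k
  rootsOfUnity-≤ {suc k} {n} _ y y-distinct y^k≈1 with n ℕ.≤? suc k
  ... | yes n≤k = n≤k
  ... | no  n≰k = contradiction -1≈0 -1≉0
    where
    -- The polynomial x ^ suc k - 1. It has k + 2 coefficients, at most the number n of zeros, and
    -- its constant coefficient is -1.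
    a : ℕ → Carrier
    a i = 1# * monomial (suc k) i + (- 1#) * monomial 0 i
    vanish : ∀ i → ev (suc (suc k)) a (y i) ≈ 0#
    vanish i = begin
      ev (suc (suc k)) a (y i)
        ≈⟨ ev-linear (suc (suc k)) (monomial (suc k)) (monomial 0) 1# (- 1#) (y i) ⟨
      1# * ev (suc (suc k)) (monomial (suc k)) (y i) + (- 1#) * ev (suc (suc k)) (monomial 0) (y i)
        ≈⟨ +-cong (*-congˡ (ev-monomial (ℕ.n<1+n (suc k)) (y i))) (*-congˡ (ev-monomial {suc (suc k)} {0} (s≤s z≤n) (y i))) ⟩
      1# * y i ^ suc k + (- 1#) * 1#   ≈⟨ +-congʳ (*-congˡ (y^k≈1 i)) ⟩
      1# * 1# + (- 1#) * 1#            ≈⟨ solve 0 (:1 :* :1 :+ (:- :1) :* :1 := :0) refl ⟩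
      0#                               ∎
    -- The left side is `a 0` as it unfolds.
    -1≈0 : 1# * 0# + (- 1#) * 1# ≈ 0#
    -1≈0 = vanishing⇒coeff≈0-≤ (ℕ.≰⇒> n≰k) a y y-distinct vanish 0 (s≤s z≤n)
    -1≉0 : ¬ 1# * 0# + (- 1#) * 1# ≈ 0#
    -1≉0 -1≈0 = 1≉0 (begin
      1#                               ≈⟨ solve 0 (:1 := :- (:1 :* :0 :+ (:- :1) :* :1)) refl ⟩
      - (1# * 0# + (- 1#) * 1#)        ≈⟨ -‿cong -1≈0 ⟩
      - 0#                             ≈⟨ -0#≈0# ⟩
      0#                               ∎)

  -- Characteristic p and the Frobenius map

  module Characteristic (p : ℕ) (p-prime : Prime p) (ιp≈0 : ι p ≈ 0#) where

    ∣⇒ι≈0 : ∀ {m} → p ∣ m → ι m ≈ 0#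
    ∣⇒ι≈0 (divides q ≡.refl) = trans (ι-* q p) (trans (*-congˡ ιp≈0) (zeroʳ _))

    ∤⇒ι≉0 : ∀ {m} → ¬ p ∣ m → ¬ ι m ≈ 0#
    ∤⇒ι≉0 {m} p∤m ιm≈0 = 1≉0 (bézout (coprime-Bézout coprime))
      where
      coprime : Coprime p m
      coprime (d∣p , d∣m) with prime⇒irreducible p-prime d∣p
      ... | inj₁ d≡1   = d≡1
      ... | inj₂ ≡.refl = contradiction d∣m p∤m
      -- A Bézout relation between natural numbers comes in two orientations; stating the step for
      -- arbitrary a and b serves both.
      vanish : ∀ {a b} x y → ι a ≈ 0# → ι b ≈ 0# → 1 ℕ.+ y ℕ.* b ≡ x ℕ.* a → 1# ≈ 0#
      vanish {a} {b} x y a≈0 b≈0 eq = begin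
        1#                   ≈⟨ solve 1 (λ y → :1 := :1 :+ y :* :0) refl (ι y) ⟩
        1# + ι y * 0#        ≈⟨ +-congˡ (*-congˡ b≈0) ⟨
        1# + ι y * ι b       ≈⟨ +-congˡ (ι-* y b) ⟨
        1# + ι (y ℕ.* b)     ≈⟨ ι-suc (y ℕ.* b) ⟨
        ι (suc (y ℕ.* b))    ≈⟨ ι-≡ eq ⟩
        ι (x ℕ.* a)          ≈⟨ ι-* x a ⟩
        ι x * ι a            ≈⟨ *-congˡ a≈0 ⟩
        ι x * 0#             ≈⟨ zeroʳ _ ⟩
        0#                   ∎
      bézout : Bézout.Identity 1 p m → 1# ≈ 0#
      bézout (Bézout.+- x y eq) = vanish x y ιp≈0 ιm≈0 eq
      bézout (Bézout.-+ x y eq) = vanish y x ιm≈0 ιp≈0 eq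

    private
      -- By absorption `p` divides k (p C k), and it does not divide k because 0 < k < p. Since `p`
      -- is a parameter, `helper` replaces it by a variable that can be matched as a successor.
      ιpCk≈0 : ∀ k → 0 < k → k < p → ι (p C k) ≈ 0#
      ιpCk≈0 (suc k) _ k<p = helper p ≡.refl
        where
        helper : ∀ n → n ≡ p → ι (n C suc k) ≈ 0#
        helper zero    ≡.refl = contradiction k<p λ ()
        helper (suc n) ≡.refl with euclidsLemma (suc k) (suc n C suc k) p-prime
                                     (divides (n C k) (≡.trans (absorption n k) (ℕ.*-comm (suc n) (n C k))))
        ... | inj₁ p∣k = contradiction (∣⇒≤ p∣k) (ℕ.<⇒≱ k<p)
        ... | inj₂ p∣C = ∣⇒ι≈0 p∣C

    frobenius-+ : ∀ x y → (x + y) ^ p ≈ x ^ p + y ^ p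
    frobenius-+ x y = helper p ≡.refl
      where
      helper : ∀ n → n ≡ p → (x + y) ^ n ≈ x ^ n + y ^ n
      helper zero    ≡.refl = contradiction (prime⇒nonZero p-prime) λ ()
      helper (suc n) ≡.refl = begin
        (x + y) ^ suc n                                              ≈⟨ binomial (suc n) x y ⟩
        (b 0 + x * ev n (b ∘ suc) x) + x ^ suc n                     ≈⟨ +-congʳ (+-congˡ (*-congˡ (ev-zero n b≈0))) ⟩
        (ι (suc n C 0) * y ^ suc n + x * 0#) + x ^ suc n             ≈⟨ +-congʳ (+-congʳ (*-congʳ (ι-≡ (nC0≡1 (suc n))))) ⟩
        (1# * y ^ suc n + x * 0#) + x ^ suc n
          ≈⟨ solve 3 (λ Y x X → (:1 :* Y :+ x :* :0) :+ X := X :+ Y) refl (y ^ suc n) x (x ^ suc n) ⟩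
        x ^ suc n + y ^ suc n                                        ∎
        where
        b = binomialCoeff (suc n) y
        b≈0 : ∀ i → i < n → b (suc i) ≈ 0#
        b≈0 i i<n = trans (*-congʳ (ιpCk≈0 (suc i) (s≤s z≤n) (s≤s i<n))) (zeroˡ _)

    frobenius^-+ : ∀ v x y → (x + y) ^ (p ℕ.^ v) ≈ x ^ (p ℕ.^ v) + y ^ (p ℕ.^ v)
    frobenius^-+ zero    x y = solve 2 (λ x y → (x :+ y) :* :1 := x :* :1 :+ y :* :1) refl x y
    frobenius^-+ (suc v) x y = begin
      (x + y) ^ (p ℕ.* q)           ≈⟨ ^-assocʳ (x + y) p q ⟨
      ((x + y) ^ p) ^ q             ≈⟨ ^-congˡ q (frobenius-+ x y) ⟩
      (x ^ p + y ^ p) ^ q           ≈⟨ frobenius^-+ v (x ^ p) (y ^ p) ⟩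
      (x ^ p) ^ q + (y ^ p) ^ q     ≈⟨ +-cong (^-assocʳ x p q) (^-assocʳ y p q) ⟩
      x ^ (p ℕ.* q) + y ^ (p ℕ.* q) ∎
      where q = p ℕ.^ v

    -- Additivity applied to (x - y) + y; this avoids the sign (-1) ^ (p ^ v) and a case distinction
    -- at p = 2.
    frobenius^-‿- : ∀ v x y → (x - y) ^ (p ℕ.^ v) ≈ x ^ (p ℕ.^ v) - y ^ (p ℕ.^ v)
    frobenius^-‿- v x y = begin
      (x - y) ^ q                     ≈⟨ solve 2 (λ A B → A := (A :+ B) :- B) refl ((x - y) ^ q) (y ^ q) ⟩
      ((x - y) ^ q + y ^ q) - y ^ q   ≈⟨ +-congʳ (frobenius^-+ v (x - y) y) ⟨
      ((x - y) + y) ^ q - y ^ q       ≈⟨ +-congʳ (^-congˡ q (solve 2 (λ x y → (x :- y) :+ y := x) refl x y)) ⟩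
      x ^ q - y ^ q                   ∎
      where q = p ℕ.^ v

    -- If n = m p, then (x ^ m - 1) ^ p = x ^ n - 1 = 0 at every given point, so all n points would
    -- be m-th roots of unity although m < n.
    rootsOfUnity⇒ιn≉0 : ∀ {n} → 0 < n → (g : Fin n → Carrier) → Distinct g → (∀ i → g i ^ n ≈ 1#) → ¬ ι n ≈ 0#
    rootsOfUnity⇒ιn≉0 {n} 0<n g g-distinct g^n≈1 with p ∣? n
    ... | no  p∤n                  = ∤⇒ι≉0 p∤n
    ... | yes (divides m n≡m*p) = λ _ → ℕ.<⇒≱ m<n (rootsOfUnity-≤ 0<m g g-distinct g^m≈1)
      where
      0<m : 0 < m
      0<m = ℕ.n≢0⇒n>0 λ { ≡.refl → ℕ.<⇒≢ 0<n (≡.sym n≡m*p) }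
      m<n : m < n
      m<n = ≡.subst (m <_) (≡.sym n≡m*p)
        (ℕ.m<m*n m p {{ℕ.>-nonZero 0<m}} (ℕ.nonTrivial⇒n>1 p {{prime⇒nonTrivial p-prime}}))
      frobenius-- : ∀ x → (x - 1#) ^ p ≈ x ^ p - 1# ^ p
      frobenius-- x = ≡.subst (λ q → (x - 1#) ^ q ≈ x ^ q - 1# ^ q) (ℕ.*-identityʳ p) (frobenius^-‿- 1 x 1#)
      g^m≈1 : ∀ i → g i ^ m ≈ 1#
      g^m≈1 i = x-y≈0⇒x≈y (x^n≈0⇒x≈0 p (begin
        (g i ^ m - 1#) ^ p         ≈⟨ frobenius-- (g i ^ m) ⟩
        (g i ^ m) ^ p - 1# ^ p     ≈⟨ +-cong (^-assocʳ (g i) m p) (-‿cong (1^n≈1 p)) ⟩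
        g i ^ (m ℕ.* p) - 1#       ≈⟨ +-congʳ (^-congʳ (g i) (≡.sym n≡m*p)) ⟩
        g i ^ n - 1#               ≈⟨ x≈y⇒x-y≈0 (g^n≈1 i) ⟩
        0#                         ∎))

m+n≡o⇒o∸m≡n : ∀ m {n o} → m ℕ.+ n ≡ o → o ∸ m ≡ n
m+n≡o⇒o∸m≡n m {n} ≡.refl = ℕ.m+n∸m≡n m n

nC-sym : ∀ {n} i j → i ℕ.+ j ≡ n → n C i ≡ n C j
nC-sym {n} i j i+j≡n = ≡.trans (nCk≡nC[n∸k] (≡.subst (i ≤_) i+j≡n (ℕ.m≤m+n i j)))
                               (≡.cong (n C_) (m+n≡o⇒o∸m≡n i i+j≡n))

-- The neighbour condition on the roots of unity

module Neighbours {c ℓ} (F : CommutativeRing c ℓ) (isField : IsField F)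
  (_≟_ : Decidable (CommutativeRing._≈_ F)) where

  open FieldProperties F isField _≟_

  -- Doubled, because 2 is not known to be invertible; the doubled coefficient is also what
  -- `reflection` produces at i = 1.
  2C₂ : ∀ n → ι (n C 2) + ι (n C 2) ≈ ι n * ι n - ι n
  2C₂ zero = solve 0 (:0 :+ :0 := :0 :* :0 :- :0) refl
  2C₂ (suc n) = begin
    ι (suc n C 2) + ι (suc n C 2)          ≈⟨ solve 1 (λ x → x :+ x := (:1 :+ :1) :* x) refl _ ⟩
    ι 2 * ι (suc n C 2)                    ≈⟨ ι-* 2 (suc n C 2) ⟨
    ι (2 ℕ.* (suc n C 2))                  ≡⟨ ≡.cong ι (absorption n 1) ⟩
    ι (suc n ℕ.* (n C 1))                  ≡⟨ ≡.cong (λ k → ι (suc n ℕ.* k)) (nC1≡n n) ⟩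
    ι (suc n ℕ.* n)                        ≈⟨ ι-* (suc n) n ⟩
    ι (suc n) * ι n                        ≈⟨ *-congʳ (ι-suc n) ⟩
    (1# + ι n) * ι n                       ≈⟨ solve 1 (λ n → (:1 :+ n) :* n := (:1 :+ n) :* (:1 :+ n) :- (:1 :+ n)) refl (ι n) ⟩
    (1# + ι n) * (1# + ι n) - (1# + ι n)   ≈⟨ +-cong (*-cong (ι-suc n) (ι-suc n)) (-‿cong (ι-suc n)) ⟨
    ι (suc n) * ι (suc n) - ι (suc n)      ∎

  module RootsOfUnity {n} (0<n : 0 < n) (g : Fin n → Carrier) (g-distinct : Distinct g) (g^n≈1 : ∀ i → g i ^ n ≈ 1#)
    (ιn≉0 : ¬ ι n ≈ 0#)
    (d : Carrier) (d≉0 : ¬ d ≈ 0#)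
    (neighbour : ∀ i → (g i + d) ^ n ≈ 1# ⊎ (g i - d) ^ n ≈ 1#) where

    private
      -- The coefficients, leading terms omitted, of (z - d²) ^ n in z = x² and of (x + d) ^ n + (x
      -- - d) ^ n in x.
      b r : ℕ → Carrier
      b   = binomialCoeff n (- (d * d))
      r j = 1# * binomialCoeff n d j + 1# * binomialCoeff n (- d) j

    -- ((x + d) ^ n − 1) ((x − d) ^ n − 1) vanishes on the roots of unity, where it agrees
    -- with (x² − d²) ^ n − (x + d) ^ n − (x − d) ^ n + 1; now reduce modulo x ^ n − 1.
    reduced-coeff : ∀ k → k < n → dilate b k + dilate b (n ℕ.+ k) ≈ r k
    reduced-coeff k k<n = x-y≈0⇒x≈y (trans
      (solve 3 (λ x y z → (x :+ y) :- z := :1 :* (:1 :* x :+ :1 :* y) :+ (:- :1) :* z) refl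
         (dilate b k) (dilate b (n ℕ.+ k)) (r k))
      (vanishing⇒coeff≈0 n a g g-distinct vanish k k<n))
      where
      -- In `a₁` the coefficients at j and n + j are added, since x ^ (n + j) = x ^ j on the roots
      -- of unity.
      a a₁ : ℕ → Carrier
      a₁ j = 1# * dilate b j + 1# * dilate b (n ℕ.+ j)
      a j  = 1# * a₁ j + (- 1#) * r j
      vanish : ∀ i → ev n a (g i) ≈ 0#
      vanish i = begin
        ev n a x                                             ≈⟨ ev-linear n a₁ r 1# (- 1#) x ⟨
        1# * ev n a₁ x + (- 1#) * ev n r x                   ≈⟨ +-cong (*-congˡ a₁≈B) (*-congˡ (sym (ev-linear n _ _ 1# 1# x))) ⟩
        -- The constants cancel: (B + 1) - (A₁ + 1) - (A₂ + 1) + 1 = B - A₁ - A₂, so `a` needs no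
        -- correction at index 0.
        1# * B + (- 1#) * (1# * A₁ + 1# * A₂)
          ≈⟨ solve 3 (λ B A A′ → :1 :* B :+ (:- :1) :* (:1 :* A :+ :1 :* A′)
                              := ((B :+ :1) :- (A :+ :1) :* (A′ :+ :1)) :+ ((A :+ :1) :- :1) :* ((A′ :+ :1) :- :1)) refl B A₁ A₂ ⟩
        ((B + 1#) - (A₁ + 1#) * (A₂ + 1#)) + ((A₁ + 1#) - 1#) * ((A₂ + 1#) - 1#)
          ≈⟨ +-cong (x≈y⇒x-y≈0 (sym UV)) (*-cong (+-congʳ (sym U)) (+-congʳ (sym V))) ⟩
        0# + ((x + d) ^ n - 1#) * ((x - d) ^ n - 1#)         ≈⟨ +-identityˡ _ ⟩
        ((x + d) ^ n - 1#) * ((x - d) ^ n - 1#)              ≈⟨ [ left , right ]′ (neighbour i) ⟩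
        0#                                                   ∎
        where
        x = g i
        A₁ = ev n (binomialCoeff n d) x
        A₂ = ev n (binomialCoeff n (- d)) x
        B  = ev n b (x * x)
        a₁≈B : ev n a₁ x ≈ B
        a₁≈B = begin
          ev n a₁ x                                            ≈⟨ ev-linear n (dilate b) (λ j → dilate b (n ℕ.+ j)) 1# 1# x ⟨
          1# * ev n (dilate b) x + 1# * ev n (λ j → dilate b (n ℕ.+ j)) x
            ≈⟨ +-cong (*-identityˡ _) (*-congʳ (sym (g^n≈1 i))) ⟩
          ev n (dilate b) x + x ^ n * ev n (λ j → dilate b (n ℕ.+ j)) x
            ≈⟨ ev-split n n (dilate b) x ⟨
          ev (n ℕ.+ n) (dilate b) x                            ≈⟨ ev-dilate n b x ⟩
          B                                                    ∎
        U : (x + d) ^ n ≈ A₁ + 1#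
        U = trans (binomial n x d) (+-congˡ (g^n≈1 i))
        V : (x - d) ^ n ≈ A₂ + 1#
        V = trans (binomial n x (- d)) (+-congˡ (g^n≈1 i))
        UV : (A₁ + 1#) * (A₂ + 1#) ≈ B + 1#
        UV = begin
          (A₁ + 1#) * (A₂ + 1#)                     ≈⟨ *-cong U V ⟨
          (x + d) ^ n * (x - d) ^ n                 ≈⟨ ^-distrib-* (x + d) (x - d) n ⟨
          ((x + d) * (x - d)) ^ n                   ≈⟨ ^-congˡ n (solve 2 (λ x d → (x :+ d) :* (x :- d) := x :* x :+ (:- (d :* d))) refl x d) ⟩
          (x * x + - (d * d)) ^ n                   ≈⟨ binomial n (x * x) (- (d * d)) ⟩
          B + (x * x) ^ n                           ≈⟨ +-congˡ (^-distrib-* x x n) ⟩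
          B + x ^ n * x ^ n                         ≈⟨ +-congˡ (*-cong (g^n≈1 i) (g^n≈1 i)) ⟩
          B + 1# * 1#                               ≈⟨ +-congˡ (*-identityˡ 1#) ⟩
          B + 1#                                    ∎
        left : (x + d) ^ n ≈ 1# → ((x + d) ^ n - 1#) * ((x - d) ^ n - 1#) ≈ 0#
        left eq = trans (*-congʳ (x≈y⇒x-y≈0 eq)) (zeroˡ _)
        right : (x - d) ^ n ≈ 1# → ((x + d) ^ n - 1#) * ((x - d) ^ n - 1#) ≈ 0#
        right eq = trans (*-congˡ (x≈y⇒x-y≈0 eq)) (zeroʳ _)

    -- Compare the coefficients of x². As n - 2 is odd, the two terms of `r 2` cancel; as n + 2 is
    -- odd, nothing is folded down from above. What remains is n (-d²) ^ (n - 1), which is nonzero.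
    -- For n = 1 there is no coefficient at index 2.
    ¬odd : ∀ k → ¬ n ≡ suc (suc k ℕ.* 2)
    ¬odd k ≡.refl = *-nonzero ιn≉0 (^-nonzero -d²≉0 (suc k ℕ.* 2)) (begin
      ι n * (- (d * d)) ^ (suc k ℕ.* 2)     ≡⟨ ≡.cong (λ i → ι i * (- (d * d)) ^ (suc k ℕ.* 2)) (nC1≡n n) ⟨
      b 1                                   ≈⟨ +-identityʳ _ ⟨
      b 1 + 0#                              ≡⟨ ≡.cong (b 1 +_) (dilate-odd b (2 ℕ.+ k)) ⟨
      dilate b 2 + dilate b (5 ℕ.+ k ℕ.* 2) ≡⟨ ≡.cong (λ i → dilate b 2 + dilate b i) (ℕ.+-comm 2 n) ⟩
      dilate b 2 + dilate b (n ℕ.+ 2)       ≈⟨ reduced-coeff 2 (s≤s (s≤s (s≤s z≤n))) ⟩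
      r 2                                   ≈⟨ +-congˡ (*-congˡ (*-congˡ ([-x]^[1+k*2] d k))) ⟩
      1# * (ι (n C 2) * D) + 1# * (ι (n C 2) * - D)
        ≈⟨ solve 2 (λ c D → :1 :* (c :* D) :+ :1 :* (c :* (:- D)) := :0) refl (ι (n C 2)) D ⟩
      0#                                    ∎)
      where
      D = d ^ suc (k ℕ.* 2)
      -d²≉0 : ¬ - (d * d) ≈ 0#
      -d²≉0 eq = *-nonzero d≉0 d≉0 (trans (sym (-‿involutive _)) (trans (-‿cong eq) -0#≈0#))

    -- Even order n = 2h

    module Even (h : ℕ) (n≡h*2 : n ≡ h ℕ.* 2) where

      u : Carrier
      u = d ^ n

      coeff : ℕ → Carrier
      coeff i = -1^ i * ι (n C i)

      -- The reduced identity at x ^ (2i). The indices 2i and n + 2i = 2(h + i) of `dilate b`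
      -- contribute b i and b (h + i), and n C (h + i) = n C j by symmetry. Every term contains d ^
      -- (2j), which cancels and leaves only u. The bound 0 < j keeps 2i below n.
      reflection : ∀ i j → i ℕ.+ j ≡ h → 0 < j →
                   u * coeff i + coeff j ≈ ι (n C (i ℕ.* 2)) + ι (n C (i ℕ.* 2))
      reflection i j i+j≡h 0<j = *-cancelʳ w≉0 (begin
        (u * coeff i + coeff j) * w
          ≈⟨ solve 6 (λ u s c s′ c′ w → (u :* (s :* c) :+ s′ :* c′) :* w
                   := c :* (s :* (u :* w)) :+ c′ :* (s′ :* w)) refl u (-1^ i) (ι (n C i)) (-1^ j) (ι (n C j)) w ⟩
        ι (n C i) * (-1^ i * (u * w)) + ι (n C j) * (-1^ j * w)
          ≈⟨ +-cong (*-congˡ lower) (*-cong (ι-≡ (nC-sym (h ℕ.+ i) j h+i+j≡n)) upper) ⟨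
        b i + b (h ℕ.+ i)
          ≡⟨ ≡.cong₂ _+_ (dilate-even b i) (≡.trans (≡.cong (dilate b) n+2i) (dilate-even b (h ℕ.+ i))) ⟨
        dilate b (i ℕ.* 2) + dilate b (n ℕ.+ i ℕ.* 2)
          ≈⟨ reduced-coeff (i ℕ.* 2) 2i<n ⟩
        r (i ℕ.* 2)
          ≡⟨ ≡.cong (λ k → 1# * (B * d ^ k) + 1# * (B * (- d) ^ k)) (m+n≡o⇒o∸m≡n (i ℕ.* 2) 2i+2j≡n) ⟩
        1# * (B * w) + 1# * (B * (- d) ^ (j ℕ.* 2))
          ≈⟨ +-congˡ (*-congˡ (*-congˡ ([-x]^[k*2] d j))) ⟩
        1# * (B * w) + 1# * (B * w)
          ≈⟨ solve 2 (λ B w → :1 :* (B :* w) :+ :1 :* (B :* w) := (B :+ B) :* w) refl B w ⟩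
        (B + B) * w ∎)
        where
        w = d ^ (j ℕ.* 2)
        w≉0 = ^-nonzero d≉0 (j ℕ.* 2)
        B = ι (n C (i ℕ.* 2))
        n≡[i+j]2 : n ≡ (i ℕ.+ j) ℕ.* 2
        n≡[i+j]2 = ≡.trans n≡h*2 (≡.cong (ℕ._* 2) (≡.sym i+j≡h))
        2i+2j≡n : i ℕ.* 2 ℕ.+ j ℕ.* 2 ≡ n
        2i+2j≡n = ≡.trans (≡.sym (ℕ.*-distribʳ-+ 2 i j)) (≡.sym n≡[i+j]2)
        2i<n : i ℕ.* 2 < n
        2i<n = ≡.subst (i ℕ.* 2 <_) 2i+2j≡n (ℕ.m<m+n (i ℕ.* 2) (ℕ.*-monoˡ-< 2 0<j))
        h+i+j≡n : h ℕ.+ i ℕ.+ j ≡ n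
        h+i+j≡n = ≡.trans (ℕ.+-assoc h i j) (≡.trans (≡.cong (h ℕ.+_) i+j≡h) (≡.trans (≡.sym (n*2≡n+n h)) (≡.sym n≡h*2)))
        n+2i : n ℕ.+ i ℕ.* 2 ≡ (h ℕ.+ i) ℕ.* 2
        n+2i = ≡.trans (≡.cong (ℕ._+ i ℕ.* 2) n≡h*2) (≡.sym (ℕ.*-distribʳ-+ 2 h i))
        -1^[i+2j] : ∀ i j → -1^ (i ℕ.+ j ℕ.* 2) ≈ -1^ i
        -1^[i+2j] i j = begin
          -1^ (i ℕ.+ j ℕ.* 2)        ≈⟨ ^-homo-* (- 1#) i (j ℕ.* 2) ⟩
          -1^ i * -1^ (j ℕ.* 2)      ≈⟨ *-congˡ (trans ([-x]^[k*2] 1# j) (1^n≈1 (j ℕ.* 2))) ⟩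
          -1^ i * 1#                 ≈⟨ *-identityʳ _ ⟩
          -1^ i                      ∎
        [d²]^ : ∀ k → (d * d) ^ k ≈ d ^ (k ℕ.* 2)
        [d²]^ k = begin
          (d * d) ^ k            ≈⟨ ^-congˡ k (*-congˡ (*-identityʳ d)) ⟨
          (d ^ 2) ^ k            ≈⟨ ^-assocʳ d 2 k ⟩
          d ^ (2 ℕ.* k)          ≡⟨ ≡.cong (d ^_) (ℕ.*-comm 2 k) ⟩
          d ^ (k ℕ.* 2)          ∎
        lower : (- (d * d)) ^ (n ∸ i) ≈ -1^ i * (u * w)
        lower = begin
          (- (d * d)) ^ (n ∸ i)
            ≡⟨ ≡.cong ((- (d * d)) ^_) (m+n≡o⇒o∸m≡n i (≡.trans
                 (solveℕ 2 (λ i j → i ⊕ (i ⊕ j ⊛ conℕ 2) ⊜ (i ⊕ j) ⊛ conℕ 2) ≡.refl i j) (≡.sym n≡[i+j]2))) ⟩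
          (- (d * d)) ^ (i ℕ.+ j ℕ.* 2)           ≈⟨ [-x]^n (d * d) (i ℕ.+ j ℕ.* 2) ⟩
          -1^ (i ℕ.+ j ℕ.* 2) * (d * d) ^ (i ℕ.+ j ℕ.* 2)
            ≈⟨ *-cong (-1^[i+2j] i j) ([d²]^ (i ℕ.+ j ℕ.* 2)) ⟩
          -1^ i * d ^ ((i ℕ.+ j ℕ.* 2) ℕ.* 2)
            ≡⟨ ≡.cong (λ k → -1^ i * d ^ k) (≡.trans
                 (solveℕ 2 (λ i j → (i ⊕ j ⊛ conℕ 2) ⊛ conℕ 2 ⊜ (i ⊕ j) ⊛ conℕ 2 ⊕ j ⊛ conℕ 2) ≡.refl i j)
                 (≡.cong (ℕ._+ j ℕ.* 2) (≡.sym n≡[i+j]2))) ⟩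
          -1^ i * d ^ (n ℕ.+ j ℕ.* 2)             ≈⟨ *-congˡ (^-homo-* d n (j ℕ.* 2)) ⟩
          -1^ i * (u * w)                         ∎
        upper : (- (d * d)) ^ (n ∸ (h ℕ.+ i)) ≈ -1^ j * w
        upper = begin
          (- (d * d)) ^ (n ∸ (h ℕ.+ i))   ≡⟨ ≡.cong ((- (d * d)) ^_) (m+n≡o⇒o∸m≡n (h ℕ.+ i) h+i+j≡n) ⟩
          (- (d * d)) ^ j                 ≈⟨ [-x]^n (d * d) j ⟩
          -1^ j * (d * d) ^ j             ≈⟨ *-congˡ ([d²]^ j) ⟩
          -1^ j * w                       ∎

      -- The ratio of consecutive binomial coefficients with the alternating sign included. It ties
      -- together the middle coefficients at h, h - 1 and h - 2, for which `reflection` gives a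
      -- second expression.
      recurrence : ∀ k j → k ℕ.+ j ≡ n → ι (suc k) * coeff (suc k) ≈ - (ι j * coeff k)
      recurrence k j k+j≡n = begin
        ι (suc k) * (- 1# * -1^ k * ι (n C suc k))
          ≈⟨ solve 3 (λ a s c → a :* ((:- :1) :* s :* c) := :- (s :* (a :* c))) refl (ι (suc k)) (-1^ k) (ι (n C suc k)) ⟩
        - (-1^ k * (ι (suc k) * ι (n C suc k)))    ≈⟨ -‿cong (*-congˡ absorb) ⟩
        - (-1^ k * (ι j * ι (n C k)))
          ≈⟨ -‿cong (solve 3 (λ s j c → s :* (j :* c) := j :* (s :* c)) refl (-1^ k) (ι j) (ι (n C k))) ⟩
        - (ι j * (-1^ k * ι (n C k)))              ∎
        where
        absorb : ι (suc k) * ι (n C suc k) ≈ ι j * ι (n C k)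
        absorb = begin
          ι (suc k) * ι (n C suc k)         ≈⟨ ι-* (suc k) (n C suc k) ⟨
          ι (suc k ℕ.* (n C suc k))         ≡⟨ ≡.cong ι (≡.subst (λ n → suc k ℕ.* (n C suc k) ≡ j ℕ.* (n C k)) k+j≡n ([k+1]C[k+1]≡jCk k j)) ⟩
          ι (j ℕ.* (n C k))                 ≈⟨ ι-* j (n C k) ⟩
          ι j * ι (n C k)                   ∎

      -- If u = 1, the reflections at i = 0 and i = 1 determine the coefficients at h and h - 1; if
      -- u ≠ 1, the coefficients at i and h - i agree for i = 1 and i = 2. In both cases
      -- `recurrence` turns these values into an equation in n alone, whose factors are powers of n
      -- and of n + 1.
      ι[n+1]≈0 : ∀ t → h ≡ 3 ℕ.+ t → ι (suc n) ≈ 0#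
      ι[n+1]≈0 t h≡3+t = trans (ι-suc n) (by-cases (u ≟ 1#))
        where
        h≡′ : ∀ k j → k ℕ.+ j ≡ 3 ℕ.+ t → k ℕ.+ j ≡ h
        h≡′ k j eq = ≡.trans eq (≡.sym h≡3+t)
        N = ι n
        Y = coeff (2 ℕ.+ t)
        Z = coeff (1 ℕ.+ t)
        X = coeff (3 ℕ.+ t)
        H = ι h
        β = ι (n C 2)
        N≈H+H : N ≈ H + H
        N≈H+H = trans (ι-≡ (≡.trans n≡h*2 (n*2≡n+n h))) (ι-+ h h)
        c0≈1 : coeff 0 ≈ 1#
        c0≈1 = trans (*-identityˡ _) (ι-≡ (nC0≡1 n))
        c1≈-N : coeff 1 ≈ - N
        c1≈-N = trans (*-congˡ (ι-≡ (nC1≡n n))) (solve 1 (λ x → ((:- :1) :* :1) :* x := :- x) refl N)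
        c2≈β : coeff 2 ≈ β
        c2≈β = solve 1 (λ x → ((:- :1) :* ((:- :1) :* :1)) :* x := x) refl β
        ι[suc]≈H : ι (3 ℕ.+ t) ≈ H
        ι[suc]≈H = ι-≡ (≡.sym h≡3+t)
        n≡ : (3 ℕ.+ t) ℕ.* 2 ≡ n
        n≡ = ≡.trans (≡.cong (ℕ._* 2) (≡.sym h≡3+t)) (≡.sym n≡h*2)
        rec₁ : H * X ≈ - ((1# + H) * Y)
        rec₁ = begin
          H * X                        ≈⟨ *-congʳ ι[suc]≈H ⟨
          ι (3 ℕ.+ t) * X              ≈⟨ recurrence (2 ℕ.+ t) (4 ℕ.+ t) (≡.trans
            (solveℕ 1 (λ t → (conℕ 2 ⊕ t) ⊕ (conℕ 4 ⊕ t) ⊜ (conℕ 3 ⊕ t) ⊛ conℕ 2) ≡.refl t) n≡) ⟩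
          - (ι (4 ℕ.+ t) * Y)          ≈⟨ -‿cong (*-congʳ (trans (ι-suc (3 ℕ.+ t)) (+-congˡ ι[suc]≈H))) ⟩
          - ((1# + H) * Y)             ∎
        rec₂ : (H - 1#) * Y ≈ - ((1# + (1# + H)) * Z)
        rec₂ = begin
          (H - 1#) * Y                 ≈⟨ *-congʳ (begin
            H - 1#                       ≈⟨ +-congʳ ι[suc]≈H ⟨
            ι (3 ℕ.+ t) - 1#             ≈⟨ +-congʳ (ι-suc (2 ℕ.+ t)) ⟩
            (1# + ι (2 ℕ.+ t)) - 1#      ≈⟨ solve 1 (λ x → (:1 :+ x) :- :1 := x) refl _ ⟩
            ι (2 ℕ.+ t)                  ∎) ⟩
          ι (2 ℕ.+ t) * Y              ≈⟨ recurrence (1 ℕ.+ t) (5 ℕ.+ t) (≡.trans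
            (solveℕ 1 (λ t → (conℕ 1 ⊕ t) ⊕ (conℕ 5 ⊕ t) ⊜ (conℕ 3 ⊕ t) ⊛ conℕ 2) ≡.refl t) n≡) ⟩
          - (ι (5 ℕ.+ t) * Z)          ≈⟨ -‿cong (*-congʳ (trans (ι-suc (4 ℕ.+ t)) (+-congˡ (trans (ι-suc (3 ℕ.+ t)) (+-congˡ ι[suc]≈H))))) ⟩
          - ((1# + (1# + H)) * Z)      ∎
        reflection₁ : u * (- N) + Y ≈ N * N - N
        reflection₁ = trans (+-congʳ (*-congˡ (sym c1≈-N)))
          (trans (reflection 1 (2 ℕ.+ t) (h≡′ 1 _ ≡.refl) (s≤s z≤n)) (2C₂ n))
        -- Compare the reflection identity at i with the one at h ∸ i.
        u≉1⇒symmetric : ¬ u ≈ 1# → ∀ i j → i ℕ.+ j ≡ h → 0 < i → 0 < j → coeff j ≈ coeff i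
        u≉1⇒symmetric u≉1 i j i+j≡h 0<i 0<j = x-y≈0⇒x≈y (xy≈0⇒y≈0 (begin
          (u - 1#) * (coeff j - coeff i)
            ≈⟨ solve 3 (λ u x y → (u :- :1) :* (y :- x) := (u :* y :+ x) :- (u :* x :+ y)) refl u (coeff i) (coeff j) ⟩
          (u * coeff j + coeff i) - (u * coeff i + coeff j)
            ≈⟨ x≈y⇒x-y≈0 (trans (reflection j i (≡.trans (ℕ.+-comm j i) i+j≡h) 0<i)
                 (trans (+-cong flip flip) (sym (reflection i j i+j≡h 0<j)))) ⟩
          0# ∎) (λ u-1≈0 → u≉1 (x-y≈0⇒x≈y u-1≈0)))
          where
          flip : ι (n C (j ℕ.* 2)) ≈ ι (n C (i ℕ.* 2))
          flip = ι-≡ (nC-sym (j ℕ.* 2) (i ℕ.* 2) (≡.trans (≡.sym (ℕ.*-distribʳ-+ 2 j i))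
            (≡.trans (≡.cong (ℕ._* 2) (≡.trans (ℕ.+-comm j i) i+j≡h)) (≡.sym n≡h*2))))
        by-cases : Dec (u ≈ 1#) → 1# + N ≈ 0#
        -- Here X = 1 and Y = N², so `rec₁` reads H (1 + 2H)² = 0. Doubling it puts N, which is
        -- known to be nonzero, in place of H.
        by-cases (yes u≈1) = x^n≈0⇒x≈0 2 (xy≈0⇒y≈0 (begin
          N * ((1# + N) * ((1# + N) * 1#))
            ≈⟨ *-cong N≈H+H (*-cong (+-congˡ N≈H+H) (*-congʳ (+-congˡ N≈H+H))) ⟩
          (H + H) * ((1# + (H + H)) * ((1# + (H + H)) * 1#))
            ≈⟨ solve 1 (λ H → (H :+ H) :* ((:1 :+ (H :+ H)) :* ((:1 :+ (H :+ H)) :* :1))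
                            := (H :* :1 :+ (:1 :+ H) :* ((H :+ H) :* (H :+ H)))
                               :+ (H :* :1 :+ (:1 :+ H) :* ((H :+ H) :* (H :+ H)))) refl H ⟩
          (H * 1# + (1# + H) * ((H + H) * (H + H))) + (H * 1# + (1# + H) * ((H + H) * (H + H)))
            ≈⟨ +-cong E≈0 E≈0 ⟩
          0# + 0#   ≈⟨ +-identityˡ 0# ⟩
          0#        ∎) ιn≉0)
          where
          X≈1 : X ≈ 1#
          X≈1 = begin
            X                              ≈⟨ solve 2 (λ u X → X := (u :* :1 :+ X) :- u) refl u X ⟩
            (u * 1# + X) - u               ≈⟨ +-cong (+-congʳ (*-congˡ (sym c0≈1))) (-‿cong u≈1) ⟩
            (u * coeff 0 + X) - 1#         ≈⟨ +-congʳ (reflection 0 (3 ℕ.+ t) (h≡′ 0 _ ≡.refl) (s≤s z≤n)) ⟩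
            (ι (n C 0) + ι (n C 0)) - 1#   ≈⟨ +-congʳ (+-cong (ι-≡ (nC0≡1 n)) (ι-≡ (nC0≡1 n))) ⟩
            (1# + 1#) - 1#                 ≈⟨ solve 0 ((:1 :+ :1) :- :1 := :1) refl ⟩
            1#                             ∎
          Y≈N² : Y ≈ (H + H) * (H + H)
          Y≈N² = begin
            Y                              ≈⟨ solve 2 (λ N Y → Y := (:1 :* (:- N) :+ Y) :+ N) refl N Y ⟩
            (1# * (- N) + Y) + N           ≈⟨ +-congʳ (+-congʳ (*-congʳ (sym u≈1))) ⟩
            (u * (- N) + Y) + N            ≈⟨ +-congʳ reflection₁ ⟩
            (N * N - N) + N                ≈⟨ solve 1 (λ N → (N :* N :- N) :+ N := N :* N) refl N ⟩
            N * N                          ≈⟨ *-cong N≈H+H N≈H+H ⟩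
            (H + H) * (H + H)              ∎
          E≈0 : H * 1# + (1# + H) * ((H + H) * (H + H)) ≈ 0#
          E≈0 = begin
            H * 1# + (1# + H) * ((H + H) * (H + H))   ≈⟨ +-cong (*-congˡ X≈1) (*-congˡ Y≈N²) ⟨
            H * X + (1# + H) * Y                      ≈⟨ +-congʳ rec₁ ⟩
            - ((1# + H) * Y) + (1# + H) * Y           ≈⟨ -‿inverseˡ _ ⟩
            0#                                        ∎
        -- Here Y = -N and Z = β, so `rec₂` reads (H + 2) β = (H - 1) N. Multiplied by 4, with N² -
        -- N for 2β, it becomes N² (1 + N) = 0.
        by-cases (no u≉1) = xy≈0⇒y≈0 (xy≈0⇒y≈0 (begin
          N * (N * (1# + N))
            ≈⟨ *-cong N≈H+H (*-cong N≈H+H (+-congˡ N≈H+H)) ⟩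
          (H + H) * ((H + H) * (1# + (H + H)))
            ≈⟨ solve 2 (λ H β → (H :+ H) :* ((H :+ H) :* (:1 :+ (H :+ H)))
                 := con (ℤ.+ 2) :* ((:1 :+ (:1 :+ H)) :* (((H :+ H) :* (H :+ H) :- (H :+ H)) :- (β :+ β)))
                    :+ con (ℤ.+ 4) :* ((:1 :+ (:1 :+ H)) :* β :+ (H :- :1) :* (:- (H :+ H)))) refl H β ⟩
          ι 2 * ((1# + (1# + H)) * (((H + H) * (H + H) - (H + H)) - (β + β)))
            + ι 4 * ((1# + (1# + H)) * β + (H - 1#) * (- (H + H)))
            ≈⟨ +-cong (*-congˡ (*-congˡ (x≈y⇒x-y≈0 (sym 2β)))) (*-congˡ E≈0) ⟩
          ι 2 * ((1# + (1# + H)) * 0#) + ι 4 * 0#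
            ≈⟨ solve 1 (λ H → con (ℤ.+ 2) :* ((:1 :+ (:1 :+ H)) :* :0) :+ con (ℤ.+ 4) :* :0 := :0) refl H ⟩
          0# ∎) ιn≉0) ιn≉0
          where
          2β : β + β ≈ (H + H) * (H + H) - (H + H)
          2β = trans (2C₂ n) (+-cong (*-cong N≈H+H N≈H+H) (-‿cong N≈H+H))
          Y≈-N : Y ≈ - (H + H)
          Y≈-N = trans (u≉1⇒symmetric u≉1 1 (2 ℕ.+ t) (h≡′ 1 _ ≡.refl) (s≤s z≤n) (s≤s z≤n)) (trans c1≈-N (-‿cong N≈H+H))
          Z≈β : Z ≈ β
          Z≈β = trans (u≉1⇒symmetric u≉1 2 (1 ℕ.+ t) (h≡′ 2 _ ≡.refl) (s≤s z≤n) (s≤s z≤n)) c2≈β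
          E≈0 : (1# + (1# + H)) * β + (H - 1#) * (- (H + H)) ≈ 0#
          E≈0 = begin
            (1# + (1# + H)) * β + (H - 1#) * (- (H + H))   ≈⟨ +-cong (*-congˡ Z≈β) (*-congˡ Y≈-N) ⟨
            (1# + (1# + H)) * Z + (H - 1#) * Y             ≈⟨ +-congˡ rec₂ ⟩
            (1# + (1# + H)) * Z - (1# + (1# + H)) * Z      ≈⟨ -‿inverseʳ _ ⟩
            0#                                             ∎

    -- Orders with n + 1 = pᵛ m, where m is odd and at least 3

    module _ (p : ℕ) (p-prime : Prime p) (ιp≈0 : ι p ≈ 0#) where

      open Characteristic p p-prime ιp≈0

      -- If p divides n + 1 = p ^ v * m, then y = x ^ (p ^ v) satisfies y ^ m = x on the roots of
      -- unity, so the neighbour condition has degree less than 2 m ≤ n in y.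
      ¬frobenius : ∀ v s → suc n ≡ p ℕ.^ v ℕ.* (3 ℕ.+ s ℕ.* 2) → ¬ p ∣ 3 ℕ.+ s ℕ.* 2 → ¬ 3 ≤ p ℕ.^ v
      ¬frobenius v s n+1≡qm p∤m 3≤q =
        -- The coefficient of y² in `lower` is M (D e)² + 2 d β e. With d = D ^ m = D (D e) and 2β =
        -- M² - M it collapses to M² (D e)², a product of nonzero factors.
        *-nonzero (*-nonzero M≉0 M≉0) (*-nonzero (*-nonzero D≉0 D≉0) (*-nonzero e≉0 e≉0)) (begin
          (M * M) * ((D * D) * (e * e))
            ≈⟨ solve 3 (λ M D e → (M :* M) :* ((D :* D) :* (e :* e))
                 := M :* ((D :* e) :* (D :* e)) :+ (D :* (D :* e)) :* ((M :* M :- M) :* e)) refl M D e ⟩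
          M * ((D * e) * (D * e)) + (D * (D * e)) * ((M * M - M) * e)
            ≈⟨ +-congˡ (*-cong D^m≈d (*-congʳ (sym (2C₂ m)))) ⟩
          M * ((D * e) * (D * e)) + d * ((β + β) * e)
            ≈⟨ solve 5 (λ X d β e c → X :+ d :* ((β :+ β) :* e)
                 := :1 :* (:1 :* X :+ d :* (:1 :* (β :* e) :+ (:- :1) :* (β :* (:- e)))) :+ c :* :0)
                 refl (M * ((D * e) * (D * e))) d β e (- (d * d)) ⟩
          1# * (1# * (M * ((D * e) * (D * e))) + d * (1# * (β * e) + (- 1#) * (β * (- e)))) + (- (d * d)) * 0#
            ≈⟨ +-congʳ (*-congˡ (+-cong (*-congˡ (sym b1)) (*-congˡ (+-congˡ (*-congˡ (*-congˡ (sym ([-x]^[1+k*2] D s)))))))) ⟩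
          lower 2
            ≈⟨ lower≈0 2 (s≤s (s≤s (s≤s z≤n))) ⟩
          0# ∎)
        where
        q = p ℕ.^ v
        m = 3 ℕ.+ s ℕ.* 2
        M = ι m
        D = d ^ q
        e = D ^ suc (s ℕ.* 2)
        β = ι (m C 2)
        W = D ^ m
        M≉0 = ∤⇒ι≉0 p∤m
        D≉0 = ^-nonzero d≉0 q
        e≉0 = ^-nonzero D≉0 (suc (s ℕ.* 2))
        -- With A₁ and A₂ for (y ± D) ^ m without their leading terms, the neighbour condition is
        -- (A₁ - d)(A₂ + d) = 0. Since A₁ A₂ = B - y ^ m (A₁ + A₂), where B is (y² - D²) ^ m without
        -- its leading term, the product equals `lower` plus y ^ m times `upper`.
        κ r₋ r₊ l lower upper : ℕ → Carrier
        κ        = binomialCoeff m (- (D * D))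
        r₋ j     = 1# * binomialCoeff m D j + (- 1#) * binomialCoeff m (- D) j
        r₊ j     = 1# * binomialCoeff m D j + 1# * binomialCoeff m (- D) j
        l j      = 1# * dilate κ j + d * r₋ j
        lower j  = 1# * l j + (- (d * d)) * monomial 0 j
        upper j  = 1# * dilate κ (m ℕ.+ j) + (- 1#) * r₊ j
        y : Fin n → Carrier
        y i = g i ^ q
        ^qm : ∀ x → (x ^ q) ^ m ≈ x * x ^ n
        ^qm x = trans (^-assocʳ x q m) (^-congʳ x (≡.sym n+1≡qm))
        y^m≈g : ∀ i → y i ^ m ≈ g i
        y^m≈g i = trans (^qm (g i)) (trans (*-congˡ (g^n≈1 i)) (*-identityʳ (g i)))
        y-distinct : Distinct y
        y-distinct {i} {j} yi≈yj = g-distinct (trans (sym (y^m≈g i)) (trans (^-congˡ m yi≈yj) (y^m≈g j)))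
        -- From n + 1 = q m ≥ 3m > 2m. Thus y takes at least as many distinct values as there are
        -- coefficients, and no reduction is required.
        2m≤n : m ℕ.+ m ≤ n
        2m≤n = ℕ.s≤s⁻¹ (≡.subst (m ℕ.+ m <_) (≡.sym n+1≡qm)
          (ℕ.<-≤-trans (ℕ.+-monoʳ-< m (ℕ.m<m+n m (s≤s z≤n))) (ℕ.*-monoˡ-≤ m 3≤q)))
        vanish : ∀ i → ev (m ℕ.+ m) (append m lower upper) (y i) ≈ 0#
        vanish i = begin
          ev (m ℕ.+ m) (append m lower upper) x      ≈⟨ ev-append m m lower upper x ⟩
          ev m lower x + Y * ev m upper x            ≈⟨ +-cong ev-lower (*-congˡ ev-upper) ⟩
          (1# * (1# * L + d * (1# * A₁ + (- 1#) * A₂)) + (- (d * d)) * 1#) + Y * (1# * U + (- 1#) * (1# * A₁ + 1# * A₂))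
            ≈⟨ solve 7 (λ L U B A₁ A₂ Y d →
                 (:1 :* (:1 :* L :+ d :* (:1 :* A₁ :+ (:- :1) :* A₂)) :+ (:- (d :* d)) :* :1) :+ Y :* (:1 :* U :+ (:- :1) :* (:1 :* A₁ :+ :1 :* A₂))
                 := (((L :+ Y :* U) :- B) :+ ((B :+ Y :* Y) :- (A₁ :+ Y) :* (A₂ :+ Y)))
                    :+ ((A₁ :+ Y) :- (Y :+ d)) :* ((A₂ :+ Y) :- (Y :- d))) refl L U B A₁ A₂ Y d ⟩
          (((L + Y * U) - B) + ((B + Y * Y) - (A₁ + Y) * (A₂ + Y))) + ((A₁ + Y) - (Y + d)) * ((A₂ + Y) - (Y - d))
            ≈⟨ +-cong (+-cong (x≈y⇒x-y≈0 (trans (sym (ev-split m m (dilate κ) x)) (ev-dilate m κ x))) (x≈y⇒x-y≈0 product))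
                      ([ left , right ]′ (neighbour i)) ⟩
          (0# + 0#) + 0#                             ≈⟨ solve 0 ((:0 :+ :0) :+ :0 := :0) refl ⟩
          0#                                         ∎
          where
          x  = y i
          Y  = x ^ m
          A₁ = ev m (binomialCoeff m D) x
          A₂ = ev m (binomialCoeff m (- D)) x
          B  = ev m κ (x * x)
          L  = ev m (dilate κ) x
          U  = ev m (λ j → dilate κ (m ℕ.+ j)) x
          ev-lower : ev m lower x ≈ 1# * (1# * L + d * (1# * A₁ + (- 1#) * A₂)) + (- (d * d)) * 1#
          ev-lower = begin
            ev m lower x                                               ≈⟨ ev-linear m l (monomial 0) 1# (- (d * d)) x ⟨
            1# * ev m l x + (- (d * d)) * ev m (monomial 0) x
              ≈⟨ +-cong (*-congˡ (sym (ev-linear m (dilate κ) r₋ 1# d x))) (*-congˡ (ev-monomial {m} {0} (s≤s z≤n) x)) ⟩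
            1# * (1# * L + d * ev m r₋ x) + (- (d * d)) * 1#
              ≈⟨ +-congʳ (*-congˡ (+-congˡ (*-congˡ (sym (ev-linear m (binomialCoeff m D) (binomialCoeff m (- D)) 1# (- 1#) x))))) ⟩
            1# * (1# * L + d * (1# * A₁ + (- 1#) * A₂)) + (- (d * d)) * 1# ∎
          ev-upper : ev m upper x ≈ 1# * U + (- 1#) * (1# * A₁ + 1# * A₂)
          ev-upper = begin
            ev m upper x                       ≈⟨ ev-linear m (λ j → dilate κ (m ℕ.+ j)) r₊ 1# (- 1#) x ⟨
            1# * U + (- 1#) * ev m r₊ x        ≈⟨ +-congˡ (*-congˡ (sym (ev-linear m (binomialCoeff m D) (binomialCoeff m (- D)) 1# 1# x))) ⟩
            1# * U + (- 1#) * (1# * A₁ + 1# * A₂) ∎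
          product : B + Y * Y ≈ (A₁ + Y) * (A₂ + Y)
          product = begin
            B + Y * Y                              ≈⟨ +-congˡ (^-distrib-* x x m) ⟨
            B + (x * x) ^ m                        ≈⟨ binomial m (x * x) (- (D * D)) ⟨
            (x * x + - (D * D)) ^ m
              ≈⟨ ^-congˡ m (solve 2 (λ x D → x :* x :+ (:- (D :* D)) := (x :+ D) :* (x :- D)) refl x D) ⟩
            ((x + D) * (x - D)) ^ m                ≈⟨ ^-distrib-* (x + D) (x - D) m ⟩
            (x + D) ^ m * (x - D) ^ m              ≈⟨ *-cong (binomial m x D) (binomial m x (- D)) ⟩
            (A₁ + Y) * (A₂ + Y)                    ∎
          left : (g i + d) ^ n ≈ 1# → ((A₁ + Y) - (Y + d)) * ((A₂ + Y) - (Y - d)) ≈ 0#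
          left eq = trans (*-congʳ (x≈y⇒x-y≈0 (begin
            A₁ + Y                       ≈⟨ binomial m x D ⟨
            (x + D) ^ m                  ≈⟨ ^-congˡ m (frobenius^-+ v (g i) d) ⟨
            ((g i + d) ^ q) ^ m          ≈⟨ ^qm (g i + d) ⟩
            (g i + d) * (g i + d) ^ n    ≈⟨ *-congˡ eq ⟩
            (g i + d) * 1#               ≈⟨ *-identityʳ _ ⟩
            g i + d                      ≈⟨ +-congʳ (y^m≈g i) ⟨
            Y + d                        ∎))) (zeroˡ _)
          right : (g i - d) ^ n ≈ 1# → ((A₁ + Y) - (Y + d)) * ((A₂ + Y) - (Y - d)) ≈ 0#
          right eq = trans (*-congˡ (x≈y⇒x-y≈0 (begin
            A₂ + Y                       ≈⟨ binomial m x (- D) ⟨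
            (x - D) ^ m                  ≈⟨ ^-congˡ m (frobenius^-‿- v (g i) d) ⟨
            ((g i - d) ^ q) ^ m          ≈⟨ ^qm (g i - d) ⟩
            (g i - d) * (g i - d) ^ n    ≈⟨ *-congˡ eq ⟩
            (g i - d) * 1#               ≈⟨ *-identityʳ _ ⟩
            g i - d                      ≈⟨ +-congʳ (y^m≈g i) ⟨
            Y - d                        ∎))) (zeroʳ _)
        lower≈0 : ∀ j → j < m → lower j ≈ 0#
        lower≈0 j j<m = trans (reflexive (≡.sym (append-< j<m)))
          (vanishing⇒coeff≈0-≤ 2m≤n (append m lower upper) y y-distinct vanish j (ℕ.<-≤-trans j<m (ℕ.m≤m+n m m)))
        -- The constant coefficient of `lower` is -W² + 2 d W - d² = -(W - d)², because m is odd.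
        D^m≈d : W ≈ d
        D^m≈d = x-y≈0⇒x≈y (x^n≈0⇒x≈0 2 (begin
          (W - d) * ((W - d) * 1#)
            ≈⟨ solve 2 (λ W d → (W :- d) :* ((W :- d) :* :1)
                 := :- (:1 :* (:1 :* (:1 :* (:- (W :* W))) :+ d :* (:1 :* (:1 :* W) :+ (:- :1) :* (:1 :* (:- W)))) :+ (:- (d :* d)) :* :1))
                 refl W d ⟩
          - (1# * (1# * (1# * (- (W * W))) + d * (1# * (1# * W) + (- 1#) * (1# * (- W)))) + (- (d * d)) * 1#)
            ≈⟨ -‿cong (+-congʳ (*-congˡ (+-cong
                 (*-congˡ (*-cong mC0 (trans (-‿cong (sym (^-distrib-* D D m))) (sym ([-x]^[1+k*2] (D * D) (suc s))))))
                 (*-congˡ (+-cong (*-congˡ (*-congʳ mC0)) (*-congˡ (*-cong mC0 (sym ([-x]^[1+k*2] D (suc s)))))))))) ⟩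
          - lower 0
            ≈⟨ -‿cong (lower≈0 0 (s≤s z≤n)) ⟩
          - 0#
            ≈⟨ -0#≈0# ⟩
          0# ∎))
          where
          mC0 : 1# ≈ ι (m C 0)
          mC0 = ι-≡ (≡.sym (nC0≡1 m))
        b1 : dilate κ 2 ≈ M * ((D * e) * (D * e))
        b1 = *-cong (ι-≡ (nC1≡n m)) (trans ([-x]^[k*2] (D * D) (suc s)) (^-distrib-* D D (suc s ℕ.* 2)))

-- Listing and counting subsets of a finite setoid

record Enumeration {c ℓ a} (S : Setoid c ℓ) (A : Pred (Setoid.Carrier S) a) (n : ℕ) : Set (c ⊔ ℓ ⊔ a) where
  open Setoid S
  field
    element   : Fin n → Carrier
    member    : ∀ i → A (element i)
    distinct  : ∀ {i j} → element i ≈ element j → i ≡ j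
    exhaust   : ∀ {x} → A x → ∃[ i ] x ≈ element i

module _ {c ℓ a} {S : Setoid c ℓ} {A : Pred (Setoid.Carrier S) a} {n : ℕ} where
  open Setoid S

  enumeration⇒cardinality : Enumeration S A n → HasCardinality (subsetoid S A) n
  enumeration⇒cardinality e = record
    { to        = index
    ; from      = λ i → element i , member i
    ; to-cong   = λ {x} {y} x≈y → distinct (trans (sym (at-index x)) (trans x≈y (at-index y)))
    ; from-cong = λ { ≡.refl → refl }
    ; inverse   = (λ {_} {y} y≈ → distinct (trans (sym (at-index y)) y≈))
                , (λ { {x} ≡.refl → sym (at-index x) })
    }
    where
    open Enumeration e
    index : Σ Carrier A → Fin n
    index (_ , x∈A) = proj₁ (exhaust x∈A)
    at-index : ∀ x → proj₁ x ≈ element (index x)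
    at-index (_ , x∈A) = proj₂ (exhaust x∈A)

  cardinality⇒enumeration : HasCardinality (subsetoid S A) n → Enumeration S A n
  cardinality⇒enumeration card = record
    { element  = proj₁ ∘ from
    ; member   = proj₂ ∘ from
    ; distinct = λ {i} {j} i≈j → ≡.trans (≡.sym (strictlyInverseˡ i)) (≡.trans (to-cong i≈j) (strictlyInverseˡ j))
    ; exhaust  = λ x∈A → to (_ , x∈A) , sym (strictlyInverseʳ (_ , x∈A))
    }
    where open Inverse card

enumerate-Fin : ∀ {a q} {P : Pred (Fin q) a} → U.Decidable P → ∃[ n ] Enumeration (≡.setoid (Fin q)) P n
enumerate-Fin {q = zero} P? = 0 , record
  { element = λ () ; member = λ () ; distinct = λ { {()} } ; exhaust = λ { {()} } }
enumerate-Fin {q = suc q} {P} P? with enumerate-Fin (P? ∘ suc) | P? zero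
... | n , e | yes p = suc n , record
  { element  = λ { zero → zero ; (suc i) → suc (element i) }
  ; member   = λ { zero → p ; (suc i) → member i }
  ; distinct = λ { {zero} {zero} _ → ≡.refl ; {suc i} {suc j} eq → ≡.cong suc (distinct (Fin.suc-injective eq)) }
  ; exhaust  = λ { {zero} _ → zero , ≡.refl
                 ; {suc x} px → suc (proj₁ (exhaust px)) , ≡.cong suc (proj₂ (exhaust px)) }
  }
  where open Enumeration e
... | n , e | no ¬p = n , record
  { element  = suc ∘ element
  ; member   = member
  ; distinct = distinct ∘ Fin.suc-injective
  ; exhaust  = λ { {zero} p0 → contradiction p0 ¬p
                 ; {suc x} px → proj₁ (exhaust px) , ≡.cong suc (proj₂ (exhaust px)) }
  }
  where open Enumeration e

enumerate : ∀ {c ℓ a} {S : Setoid c ℓ} {q} → HasCardinality S q → {A : Pred (Setoid.Carrier S) a} →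
            A Respects Setoid._≈_ S → U.Decidable A → ∃[ n ] Enumeration S A n
enumerate {S = S} card A-resp A? with n , e ← enumerate-Fin (A? ∘ Inverse.from card) = n , record
  { element  = from ∘ element
  ; member   = member
  ; distinct = λ {i} {j} eq → distinct (≡.trans (≡.sym (strictlyInverseˡ _)) (≡.trans (to-cong eq) (strictlyInverseˡ _)))
  ; exhaust  = λ {x} x∈A → let i , to≡ = exhaust (A-resp (sym (strictlyInverseʳ x)) x∈A)
                           in i , trans (sym (strictlyInverseʳ x)) (from-cong to≡)
  }
  where
  open Setoid S
  open Inverse card
  open Enumeration e

module _ {c ℓ} (M : CommutativeMonoid c ℓ) where
  open CommutativeMonoid M
  open Sum M
  open CommutativeMonoidMult M using () renaming (_×_ to _×ᴹ_)
  open SetoidReasoning setoid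

  -- Translation by x permutes the listed elements, with translation by y as the inverse
  -- permutation. A monoid suffices, so the same lemma covers the product over `A` inside the
  -- multiplicative monoid of the field and the sum over the whole field.
  sum-translate : ∀ {a} {A : Pred Carrier a} {n} (e : Enumeration setoid A n) → let open Enumeration e in
    ∀ x y → x ∙ y ≈ ε → (∀ {z} → A z → A (x ∙ z)) → (∀ {z} → A z → A (y ∙ z)) →
    sum element ≈ n ×ᴹ x ∙ sum element
  sum-translate {n = n} e x y xy≈ε x∙ y∙ = begin
    sum element                          ≈⟨ sum-permute element (Perm.permutation σ τ στ τσ) ⟩
    sum (element ∘ σ)                    ≈⟨ sum-cong-≋ {n} σ-spec ⟨
    sum (λ i → x ∙ element i)            ≈⟨ ∑-distrib-+ {n} (λ _ → x) element ⟩
    sum {n} (λ _ → x) ∙ sum element      ≈⟨ ∙-congʳ (sum-replicate n) ⟩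
    n ×ᴹ x ∙ sum element                 ∎
    where
    open Enumeration e
    σ τ : Fin n → Fin n
    σ i = proj₁ (exhaust (x∙ (member i)))
    τ i = proj₁ (exhaust (y∙ (member i)))
    σ-spec : ∀ i → x ∙ element i ≈ element (σ i)
    σ-spec i = proj₂ (exhaust (x∙ (member i)))
    τ-spec : ∀ i → y ∙ element i ≈ element (τ i)
    τ-spec i = proj₂ (exhaust (y∙ (member i)))
    cancel : ∀ {x y} z → x ∙ y ≈ ε → x ∙ (y ∙ z) ≈ z
    cancel z eq = trans (sym (assoc _ _ z)) (trans (∙-congʳ eq) (identityˡ z))
    στ : ∀ i → σ (τ i) ≡ i
    στ i = distinct (trans (sym (σ-spec (τ i))) (trans (∙-congˡ (sym (τ-spec i))) (cancel _ xy≈ε)))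
    τσ : ∀ i → τ (σ i) ≡ i
    τσ i = distinct (trans (sym (τ-spec (σ i))) (trans (∙-congˡ (sym (σ-spec i))) (cancel _ (trans (comm y x) xy≈ε))))

-- Parity and the p-part of a natural number

even⊎odd : ∀ n → (∃[ k ] n ≡ k ℕ.* 2) ⊎ (∃[ k ] n ≡ suc (k ℕ.* 2))
even⊎odd zero    = inj₁ (0 , ≡.refl)
even⊎odd (suc n) with even⊎odd n
... | inj₁ (k , ≡.refl) = inj₂ (k , ≡.refl)
... | inj₂ (k , ≡.refl) = inj₁ (suc k , ≡.refl)

odd≢even : ∀ j k → ¬ suc (j ℕ.* 2) ≡ k ℕ.* 2
odd≢even (suc j) (suc k) eq = odd≢even j k (ℕ.suc-injective (ℕ.suc-injective eq))

factor-out : ∀ {p} → Prime p → ∀ n → 0 < n → ∃[ v ] ∃[ m ] n ≡ p ℕ.^ v ℕ.* m × ¬ p ∣ m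
factor-out {p} p-prime n = go n (ℕ.<-wellFounded n)
  where
  go : ∀ n → Acc _<_ n → 0 < n → ∃[ v ] ∃[ m ] n ≡ p ℕ.^ v ℕ.* m × ¬ p ∣ m
  go n (acc rs) 0<n with p ∣? n
  ... | no p∤n = 0 , n , ≡.sym (ℕ.*-identityˡ n) , p∤n
  ... | yes (divides m ≡.refl) with 0<m ← ℕ.n≢0⇒n>0 {m} (λ { ≡.refl → contradiction 0<n λ () })
      with v , k , eq , p∤k ← go m (rs (ℕ.m<m*n m p {{ℕ.>-nonZero 0<m}} (ℕ.nonTrivial⇒n>1 p {{prime⇒nonTrivial p-prime}}))) 0<m
      = suc v , k , ≡.trans (ℕ.*-comm m p) (≡.trans (≡.cong (p ℕ.*_) eq) (≡.sym (ℕ.*-assoc p _ k))) , p∤k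

-- Power subgroups: their order and their progressions

module PowerSubgroups {c ℓ} (F : CommutativeRing c ℓ) (isField : IsField F)
  (_≟_ : Decidable (CommutativeRing._≈_ F)) where

  open FieldProperties F isField _≟_
  open Neighbours F isField _≟_

  private
    module M = Mult semiring
    module ∑ = Sum +-commutativeMonoid

  module _ (p : ℕ) (p-prime : Prime p) (ιp≈0 : ι p ≈ 0#) where
    open Characteristic p p-prime ιp≈0

    order-of-neighbourly : ∀ {n} → 0 < n → (g : Fin n → Carrier) → Distinct g → (∀ i → g i ^ n ≈ 1#) →
      ∀ d → ¬ d ≈ 0# → (∀ i → (g i + d) ^ n ≈ 1# ⊎ (g i - d) ^ n ≈ 1#) →
      n ∈ 1 ∷ 2 ∷ 4 ∷ [] ⊎ ∃[ v ] suc n ≡ p ℕ.^ v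
    order-of-neighbourly {n} 0<n g g-distinct g^n≈1 d d≉0 neighbour = classify (even⊎odd n)
      where
      open RootsOfUnity 0<n g g-distinct g^n≈1 (rootsOfUnity⇒ιn≉0 0<n g g-distinct g^n≈1) d d≉0 neighbour
      -- Evenness of n enters as oddness of n + 1: it makes m odd and excludes pᵛ = 2.
      prime-power : ∀ h → n ≡ h ℕ.* 2 → ι (suc n) ≈ 0# → ∃[ v ] suc n ≡ p ℕ.^ v
      prime-power h n≡h*2 ι≈0 with factor-out p-prime (suc n) (s≤s z≤n)
      ... | v , m , n+1≡qm , p∤m with even⊎odd m
      ...   | inj₁ (k , ≡.refl) = contradiction
                (≡.trans (≡.cong suc (≡.sym n≡h*2)) (≡.trans n+1≡qm (≡.sym (ℕ.*-assoc (p ℕ.^ v) k 2)))) (odd≢even h (p ℕ.^ v ℕ.* k))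
      ...   | inj₂ (zero , ≡.refl) = v , ≡.trans n+1≡qm (ℕ.*-identityʳ _)
      ...   | inj₂ (suc s , ≡.refl) = contradiction (3≤ (p ℕ.^ v) n+1≡qm) (¬frobenius p p-prime ιp≈0 v s n+1≡qm p∤m)
        where
        -- The value 1 would give n + 1 = m, which p does not divide, although `ι (suc n)` vanishes.
        3≤ : ∀ q → suc n ≡ q ℕ.* (3 ℕ.+ s ℕ.* 2) → 3 ≤ q
        3≤ 0 ()
        3≤ 1 eq = contradiction ι≈0 (∤⇒ι≉0 (≡.subst (λ k → ¬ p ∣ k) (≡.sym (≡.trans eq (ℕ.*-identityˡ _))) p∤m))
        3≤ 2 eq = contradiction (≡.trans (≡.cong suc (≡.sym n≡h*2)) (≡.trans eq (ℕ.*-comm 2 (3 ℕ.+ s ℕ.* 2)))) (odd≢even h (3 ℕ.+ s ℕ.* 2))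
        3≤ (suc (suc (suc q))) _ = s≤s (s≤s (s≤s z≤n))
      classify : (∃[ k ] n ≡ k ℕ.* 2) ⊎ (∃[ k ] n ≡ suc (k ℕ.* 2)) → n ∈ 1 ∷ 2 ∷ 4 ∷ [] ⊎ ∃[ v ] suc n ≡ p ℕ.^ v
      classify (inj₂ (zero  , n≡1)) = inj₁ (here n≡1)
      classify (inj₂ (suc k , n≡))  = contradiction n≡ (¬odd k)
      classify (inj₁ (0 , n≡0))     = contradiction (≡.sym n≡0) (ℕ.<⇒≢ 0<n)
      classify (inj₁ (1 , n≡2))     = inj₁ (there (here n≡2))
      classify (inj₁ (2 , n≡4))     = inj₁ (there (there (here n≡4)))
      classify (inj₁ (suc (suc (suc t)) , n≡)) = inj₂ (prime-power (3 ℕ.+ t) n≡ (Even.ι[n+1]≈0 (3 ℕ.+ t) n≡ t ≡.refl))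

    -- Closure under addition and negation is Frobenius; the form `suc m` of the exponent supplies 0
    -- ^ q = 0.
    fixed-isSubfield : ∀ v {m} → p ℕ.^ v ≡ suc m → IsSubfield F (λ x → x ^ (p ℕ.^ v) ≈ x)
    fixed-isSubfield v {m} q≡ = record
      { resp    = λ x≈y xq → trans (^-congˡ q (sym x≈y)) (trans xq x≈y)
      ; 0∈      = 0∈
      ; 1∈      = 1^n≈1 q
      ; +-clo   = λ {x} {y} xq yq → trans (frobenius^-+ v x y) (+-cong xq yq)
      ; neg-clo = λ {x} xq → begin
          (- x) ^ q          ≈⟨ ^-congˡ q (+-identityˡ (- x)) ⟨
          (0# - x) ^ q       ≈⟨ frobenius^-‿- v 0# x ⟩
          0# ^ q - x ^ q     ≈⟨ +-cong 0∈ (-‿cong xq) ⟩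
          0# - x             ≈⟨ +-identityˡ (- x) ⟩
          - x                ∎
      ; *-clo   = λ {x} {y} xq yq → trans (^-distrib-* x y q) (*-cong xq yq)
      ; inv-clo = λ {x} {y} xq xy≈1 → *-cancelʳ {z = x} (λ x≈0 → 1≉0 (begin
          1#       ≈⟨ xy≈1 ⟨
          x * y    ≈⟨ *-congʳ x≈0 ⟩
          0# * y   ≈⟨ zeroˡ y ⟩
          0#       ∎)) (begin
          y ^ q * x          ≈⟨ *-congˡ xq ⟨
          y ^ q * x ^ q      ≈⟨ *-comm _ _ ⟩
          x ^ q * y ^ q      ≈⟨ ^-distrib-* x y q ⟨
          (x * y) ^ q        ≈⟨ ^-congˡ q xy≈1 ⟩
          1# ^ q             ≈⟨ 1^n≈1 q ⟩
          1#                 ≈⟨ xy≈1 ⟨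
          x * y              ≈⟨ *-comm x y ⟩
          y * x              ∎)
      }
      where
      q = p ℕ.^ v
      0∈ : 0# ^ q ≈ 0#
      0∈ = ^-zeroˡ q (≡.subst (0 <_) (≡.sym q≡) (s≤s z≤n))

  module _ (k : ℕ) where

    private
      A : Pred Carrier _
      A = PowerSubgroup F k

    power-resp : A Respects _≈_
    power-resp x≈y (z , z≉0 , x≈z^k) = z , z≉0 , trans (sym x≈y) x≈z^k

    power-1 : A 1#
    power-1 = 1# , 1≉0 , sym (1^n≈1 k)

    power-* : ∀ {x y} → A x → A y → A (x * y)
    power-* (z , z≉0 , x≈) (w , w≉0 , y≈) = z * w , *-nonzero z≉0 w≉0 , trans (*-cong x≈ y≈) (sym (^-distrib-* z w k))

    power-nonzero : ∀ {x} → A x → ¬ x ≈ 0#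
    power-nonzero (z , z≉0 , x≈) x≈0 = ^-nonzero z≉0 k (trans (sym x≈) x≈0)

    power-inverse : ∀ {x} → A x → ∃[ y ] A y × x * y ≈ 1#
    power-inverse {x} (z , z≉0 , x≈) with w , zw≈1 ← inverse z z≉0 = w ^ k , (w , w≉0 , refl) , (begin
      x * w ^ k       ≈⟨ *-congʳ x≈ ⟩
      z ^ k * w ^ k   ≈⟨ ^-distrib-* z w k ⟨
      (z * w) ^ k     ≈⟨ ^-congˡ k zw≈1 ⟩
      1# ^ k          ≈⟨ 1^n≈1 k ⟩
      1#              ∎)
      where
      w≉0 : ¬ w ≈ 0#
      w≉0 w≈0 = 1≉0 (trans (sym zw≈1) (trans (*-congˡ w≈0) (zeroʳ z)))

    module _ {n} (e : Enumeration setoid A n) where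
      open Enumeration e
      private module ∏ = Sum *-commutativeMonoid

      product≉0 : ∀ {m} (g : Fin m → Carrier) → (∀ i → ¬ g i ≈ 0#) → ¬ ∏.sum g ≈ 0#
      product≉0 {zero}  g g≉0 = 1≉0
      product≉0 {suc m} g g≉0 = *-nonzero (g≉0 zero) (product≉0 (g ∘ suc) (g≉0 ∘ suc))

      -- Multiplication by x permutes `A`, so the product of all its elements is x ^ n times itself,
      -- and it is nonzero.
      lagrange : ∀ {x} → A x → x ^ n ≈ 1#
      lagrange {x} x∈A with y , y∈A , xy≈1 ← power-inverse x∈A =
        sym (*-cancelʳ (product≉0 element (power-nonzero ∘ member))
          (trans (*-identityˡ _) (sum-translate *-commutativeMonoid e x y xy≈1 (power-* x∈A) (power-* y∈A))))

      order>0 : 0 < n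
      order>0 = ℕ.n≢0⇒n>0 λ { ≡.refl → contradiction (proj₁ (exhaust power-1)) λ () }

      -- The n elements of `A` are n-th roots of unity already; one more would exceed the bound on
      -- their number.
      root⇒member : U.Decidable A → ∀ {x} → x ^ n ≈ 1# → A x
      root⇒member A? {x} x^n≈1 with A? x
      ... | yes x∈A = x∈A
      ... | no  x∉A = contradiction (rootsOfUnity-≤ order>0 y y-distinct y^n≈1) (ℕ.<⇒≱ (ℕ.n<1+n n))
        where
        y : Fin (suc n) → Carrier
        y zero    = x
        y (suc i) = element i
        y-distinct : Distinct y
        y-distinct {zero}  {zero}  _  = ≡.refl
        y-distinct {zero}  {suc j} eq = contradiction (power-resp (sym eq) (member j)) x∉A
        y-distinct {suc i} {zero}  eq = contradiction (power-resp eq (member i)) x∉A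
        y-distinct {suc i} {suc j} eq = ≡.cong suc (distinct eq)
        y^n≈1 : ∀ i → y i ^ n ≈ 1#
        y^n≈1 zero    = x^n≈1
        y^n≈1 (suc i) = lagrange (member i)

      order-1 : n ≡ 1 → ∀ {x} → A x → x ≈ 1#
      order-1 ≡.refl x∈A = trans (sym (*-identityʳ _)) (lagrange x∈A)

      order-1⇒GAP : n ≡ 1 → IsGAP +-abelianGroup A
      order-1⇒GAP n≡1 = 0 , 1# , (λ ()) , (λ ()) , (λ ()) , (λ ())
        , (λ x∈A → (λ ()) , trans (order-1 n≡1 x∈A) (sym (+-identityʳ 1#)))
        , (λ (_ , x≈) → power-resp (sym (trans x≈ (+-identityʳ 1#))) power-1)

      order-2⇒GAP : n ≡ 2 → IsGAP +-abelianGroup A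
      order-2⇒GAP ≡.refl = 1 , 1# , (λ _ → 2) , (λ _ → δ) , (λ _ → s≤s (s≤s z≤n)) , (λ _ → δ≉0)
        , A⊆P , P⊆A
        where
        P : Pred Carrier _
        P = Progression +-abelianGroup {1} 1# (λ _ → 2) (λ _ → - 1# - 1#)
        δ = - 1# - 1#
        ±1 : ∀ {x} → A x → x ≈ 1# ⊎ x ≈ - 1#
        ±1 {x} x∈A = ⊎.map x-y≈0⇒x≈y x-y≈0⇒x≈y (xy≈0⇒x≈0⊎y≈0 (begin
          (x - 1#) * (x - - 1#)   ≈⟨ solve 1 (λ x → (x :- :1) :* (x :- (:- :1)) := x :* (x :* :1) :- :1) refl x ⟩
          x ^ 2 - 1#              ≈⟨ x≈y⇒x-y≈0 (lagrange x∈A) ⟩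
          0#                      ∎))
        distinct-elements : ∀ {x} → element zero ≈ x → element (suc zero) ≈ x → zero ≡ suc {1} zero
        distinct-elements eq₀ eq₁ = distinct (trans eq₀ (sym eq₁))
        -- Both elements are ±1 and they are distinct, so each sign occurs once; in particular δ =
        -- -2 is nonzero.
        -1∈A×-1≉1 : A (- 1#) × ¬ - 1# ≈ 1#
        -1∈A×-1≉1 = by-signs (±1 (member zero)) (±1 (member (suc zero)))
          where
          by-signs : element zero ≈ 1# ⊎ element zero ≈ - 1# → element (suc zero) ≈ 1# ⊎ element (suc zero) ≈ - 1# →
                     A (- 1#) × ¬ - 1# ≈ 1#
          by-signs (inj₁ a) (inj₁ b) = contradiction (distinct-elements a b) λ ()
          by-signs (inj₂ a) (inj₂ b) = contradiction (distinct-elements a b) λ ()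
          by-signs (inj₁ a) (inj₂ b) = power-resp b (member (suc zero))
                                     , λ eq → contradiction (distinct-elements a (trans b eq)) λ ()
          by-signs (inj₂ a) (inj₁ b) = power-resp a (member zero)
                                     , λ eq → contradiction (distinct-elements (trans a eq) b) λ ()
        δ≉0 : ¬ δ ≈ 0#
        δ≉0 eq = proj₂ -1∈A×-1≉1 (x-y≈0⇒x≈y eq)
        0≈ : 1# ≈ 1# + (0# + 0#)
        0≈ = solve 0 (:1 := :1 :+ (:0 :+ :0)) refl
        1≈ : - 1# ≈ 1# + ((δ + 0#) + 0#)
        1≈ = solve 0 (:- :1 := :1 :+ (((:- :1 :- :1) :+ :0) :+ :0)) refl
        A⊆P : ∀ {x} → A x → P x
        A⊆P x∈A = [ (λ x≈1 → (λ _ → zero) , trans x≈1 0≈) , (λ x≈-1 → (λ _ → suc zero) , trans x≈-1 1≈) ]′ (±1 x∈A)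
        P⊆A : ∀ {x} → P x → A x
        P⊆A {x} (m , x≈) = by-digit (m zero) x≈
          where
          by-digit : ∀ (s : Fin 2) → x ≈ 1# + (toℕ s M.× δ + 0#) → A x
          by-digit zero       x≈ = power-resp (sym (trans x≈ (sym 0≈))) power-1
          by-digit (suc zero) x≈ = power-resp (sym (trans x≈ (sym 1≈))) (proj₁ -1∈A×-1≉1)

      -- Start at 1 with differences i - 1 and -i - 1: the four corners are 1, i, -i and -1. Some i
      -- in `A` has i² ≠ 1, because 1 has at most two square roots, and then i⁴ = 1 forces i² = -1.
      order-4⇒GAP : n ≡ 4 → IsGAP +-abelianGroup A
      order-4⇒GAP ≡.refl with Fin.any? (λ j → ¬? ((element j ^ 2) ≟ 1#))
      ... | no  all²≈1 = contradiction
              (rootsOfUnity-≤ {2} (s≤s z≤n) element distinct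
                (λ j → Dec.decidable-stable ((element j ^ 2) ≟ 1#) (λ x²≉1 → all²≈1 (j , x²≉1))))
              λ { (s≤s (s≤s ())) }
      ... | yes (j , i²≉1) = 2 , 1# , (λ _ → 2) , δ , (λ _ → s≤s (s≤s z≤n)) , δ≉0 , A⊆P , P⊆A
        where
        i = element j
        i²≈-1 : i * i ≈ - 1#
        i²≈-1 = x-y≈0⇒x≈y (xy≈0⇒y≈0 (begin
          (i ^ 2 - 1#) * (i * i - - 1#)
            ≈⟨ solve 1 (λ i → (i :* (i :* :1) :- :1) :* (i :* i :- (:- :1))
                           := i :* (i :* (i :* (i :* :1))) :- :1) refl i ⟩
          i ^ 4 - 1#   ≈⟨ x≈y⇒x-y≈0 (lagrange (member j)) ⟩
          0#           ∎) (λ eq → i²≉1 (x-y≈0⇒x≈y eq)))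
        -1∈A : A (- 1#)
        -1∈A = power-resp i²≈-1 (power-* (member j) (member j))
        -i∈A : A (- i)
        -i∈A = power-resp (solve 1 (λ i → (:- :1) :* i := :- i) refl i) (power-* -1∈A (member j))
        δ : Fin 2 → Carrier
        δ zero       = i - 1#
        δ (suc zero) = - i - 1#
        δ≉0 : ∀ s → ¬ δ s ≈ 0#
        δ≉0 zero       eq = i²≉1 (trans (^-congˡ 2 (x-y≈0⇒x≈y eq)) (1^n≈1 2))
        δ≉0 (suc zero) eq = i²≉1 (trans (solve 1 (λ i → i :* (i :* :1) := (:- i) :* ((:- i) :* :1)) refl i)
                                        (trans (^-congˡ 2 (x-y≈0⇒x≈y eq)) (1^n≈1 2)))
        P : Pred Carrier _
        P = Progression +-abelianGroup {2} 1# (λ _ → 2) δ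
        fourth-roots : ∀ {x} → A x → (x ≈ 1# ⊎ x ≈ - 1#) ⊎ (x ≈ i ⊎ x ≈ - i)
        fourth-roots {x} x∈A = ⊎.map
          (⊎.map x-y≈0⇒x≈y x-y≈0⇒x≈y ∘ xy≈0⇒x≈0⊎y≈0)
          (⊎.map x-y≈0⇒x≈y x-y≈0⇒x≈y ∘ xy≈0⇒x≈0⊎y≈0) (xy≈0⇒x≈0⊎y≈0 (begin
          ((x - 1#) * (x - - 1#)) * ((x - i) * (x - - i))
            ≈⟨ solve 2 (λ x i → ((x :- :1) :* (x :- (:- :1))) :* ((x :- i) :* (x :- (:- i)))
                             := (x :* x :- :1) :* (x :* x :- i :* i)) refl x i ⟩
          (x * x - 1#) * (x * x - i * i)       ≈⟨ *-congˡ (+-congˡ (-‿cong i²≈-1)) ⟩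
          (x * x - 1#) * (x * x - - 1#)
            ≈⟨ solve 1 (λ x → (x :* x :- :1) :* (x :* x :- (:- :1)) := x :* (x :* (x :* (x :* :1))) :- :1) refl x ⟩
          x ^ 4 - 1#                           ≈⟨ x≈y⇒x-y≈0 (lagrange x∈A) ⟩
          0#                                   ∎))
        digits : Fin 2 → Fin 2 → Fin 2 → Fin 2
        digits s t zero       = s
        digits s t (suc zero) = t
        00≈ : 1# ≈ 1# + (0# + (0# + 0#))
        00≈ = solve 0 (:1 := :1 :+ (:0 :+ (:0 :+ :0))) refl
        10≈ : i ≈ 1# + (((i - 1#) + 0#) + (0# + 0#))
        10≈ = solve 1 (λ i → i := :1 :+ (((i :- :1) :+ :0) :+ (:0 :+ :0))) refl i
        01≈ : - i ≈ 1# + (0# + (((- i - 1#) + 0#) + 0#))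
        01≈ = solve 1 (λ i → :- i := :1 :+ (:0 :+ (((:- i :- :1) :+ :0) :+ :0))) refl i
        11≈ : - 1# ≈ 1# + (((i - 1#) + 0#) + (((- i - 1#) + 0#) + 0#))
        11≈ = solve 1 (λ i → :- :1 := :1 :+ (((i :- :1) :+ :0) :+ (((:- i :- :1) :+ :0) :+ :0))) refl i
        A⊆P : ∀ {x} → A x → P x
        A⊆P x∈A =
          [ [ (λ x≈1 → digits zero zero , trans x≈1 00≈)
            , (λ x≈-1 → digits (suc zero) (suc zero) , trans x≈-1 11≈) ]′
          , [ (λ x≈i → digits (suc zero) zero , trans x≈i 10≈)
            , (λ x≈-i → digits zero (suc zero) , trans x≈-i 01≈) ]′ ]′ (fourth-roots x∈A)
        P⊆A : ∀ {x} → P x → A x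
        P⊆A {x} (m , x≈) = by-digits (m zero) (m (suc zero)) x≈
          where
          by-digits : ∀ (s t : Fin 2) → x ≈ 1# + (toℕ s M.× δ zero + (toℕ t M.× δ (suc zero) + 0#)) → A x
          by-digits zero       zero       x≈ = power-resp (sym (trans x≈ (sym 00≈))) power-1
          by-digits (suc zero) zero       x≈ = power-resp (sym (trans x≈ (sym 10≈))) (member j)
          by-digits zero       (suc zero) x≈ = power-resp (sym (trans x≈ (sym 01≈))) -i∈A
          by-digits (suc zero) (suc zero) x≈ = power-resp (sym (trans x≈ (sym 11≈))) -1∈A

  -- Take any digits that represent x. A first digit 0 can be raised, as its range has at least two
  -- values; a positive one can be lowered. The other digits stay, so injectivity of the
  -- parametrization does not matter.
  progression-neighbour : ∀ {r} (a : Carrier) (L : Fin (suc r) → ℕ) (d : Fin (suc r) → Carrier) → 2 ≤ L zero →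
    let P = Progression +-abelianGroup a L d in ∀ {x} → P x → P (x + d zero) ⊎ P (x - d zero)
  progression-neighbour {r} a L d 2≤L {x} (m , x≈) = go (toℕ (m zero)) ≡.refl
    where
    P = Progression +-abelianGroup a L d
    rest : Carrier
    rest = ∑.sum {r} (λ i → toℕ (m (suc i)) M.× d (suc i))
    shift : ∀ {y} k → k < L zero → y ≈ a + (k M.× d zero + rest) → P y
    shift {y} k k<L y≈ = m′ , trans y≈ (reflexive (≡.cong (λ k → a + (k M.× d zero + rest)) (≡.sym (Fin.toℕ-fromℕ< k<L))))
      where
      m′ : ∀ i → Fin (L i)
      m′ zero    = fromℕ< k<L
      m′ (suc i) = m (suc i)
    go : ∀ k → toℕ (m zero) ≡ k → P (x + d zero) ⊎ P (x - d zero)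
    go zero eq = inj₁ (shift 1 2≤L (begin
      x + d zero                                      ≈⟨ +-congʳ x≈ ⟩
      (a + (toℕ (m zero) M.× d zero + rest)) + d zero ≡⟨ ≡.cong (λ k → (a + (k M.× d zero + rest)) + d zero) eq ⟩
      (a + (0# + rest)) + d zero
        ≈⟨ solve 3 (λ a s d → (a :+ (:0 :+ s)) :+ d := a :+ ((d :+ :0) :+ s)) refl a rest (d zero) ⟩
      a + (1 M.× d zero + rest)                       ∎))
    go (suc k) eq = inj₂ (shift k (ℕ.<-trans (≡.subst (k <_) (≡.sym eq) (ℕ.n<1+n k)) (Fin.toℕ<n (m zero))) (begin
      x - d zero                                      ≈⟨ +-congʳ x≈ ⟩
      (a + (toℕ (m zero) M.× d zero + rest)) - d zero ≡⟨ ≡.cong (λ k → (a + (k M.× d zero + rest)) - d zero) eq ⟩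
      (a + ((d zero + k M.× d zero) + rest)) - d zero
        ≈⟨ solve 4 (λ a s d e → (a :+ ((d :+ e) :+ s)) :- d := a :+ (e :+ s)) refl a rest (d zero) _ ⟩
      a + (k M.× d zero + rest)                       ∎))

  ι-^ : ∀ p f → ι (p ℕ.^ f) ≈ ι p ^ f
  ι-^ p zero    = refl
  ι-^ p (suc f) = trans (ι-* p (p ℕ.^ f)) (*-congˡ (ι-^ p f))

  GAP⇒order : ∀ {p} f k {n} → Prime p → HasCardinality setoid (p ℕ.^ f) →
    U.Decidable (PowerSubgroup F k) → Enumeration setoid (PowerSubgroup F k) n →
    ¬ (PowerSubgroup F k ≐ NonZeroElements F) → (∀ x → Generated F (PowerSubgroup F k) x) →
    IsGAP +-abelianGroup (PowerSubgroup F k) → n ∈ 1 ∷ 2 ∷ 4 ∷ []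
  GAP⇒order {p} f k {n} p-prime card A? e proper generates (r , a , L , d , 2≤L , d≉0 , A⊆P , P⊆A) =
    by-rank r L d 2≤L d≉0 A⊆P P⊆A
    where
    open Enumeration e
    A = PowerSubgroup F k
    -- Translation by 1 permutes the field; cancelling the sum of all elements leaves p ^ f times 1
    -- equal to 0, and this is the f-th power of `ι p`.
    ιp≈0 : ι p ≈ 0#
    ιp≈0 = x^n≈0⇒x≈0 f (begin
      ι p ^ f                              ≈⟨ ι-^ p f ⟨
      ι (p ℕ.^ f)                          ≈⟨ *-identityʳ _ ⟨
      ι (p ℕ.^ f) * 1#                     ≈⟨ ×≈ι* (p ℕ.^ f) 1# ⟨
      (p ℕ.^ f) M.× 1#                     ≈⟨ solve 2 (λ x s → x := (x :+ s) :- s) refl _ S ⟩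
      ((p ℕ.^ f) M.× 1# + S) - S           ≈⟨ x≈y⇒x-y≈0 (sym (sum-translate +-commutativeMonoid everything 1# (- 1#) (-‿inverseʳ 1#) _ _)) ⟩
      0#                                   ∎)
      where
      everything : Enumeration setoid (λ _ → ⊤) (p ℕ.^ f)
      everything = record
        { element  = from
        ; member   = _
        ; distinct = λ {i} {j} eq → ≡.trans (≡.sym (strictlyInverseˡ i)) (≡.trans (to-cong eq) (strictlyInverseˡ j))
        ; exhaust  = λ {x} _ → to x , sym (strictlyInverseʳ x)
        }
        where open Inverse card
      S = ∑.sum (Enumeration.element everything)
    open Characteristic p p-prime ιp≈0
    ¬prime-power : ¬ (∃[ v ] suc n ≡ p ℕ.^ v)
    ¬prime-power (v , n+1≡q) = proper (power-nonzero k , λ {x} x≉0 → root⇒member k e A? (^n≈1 x x≉0))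
      where
      ^q : ∀ {x} → x ^ (p ℕ.^ v) ≈ x * x ^ n
      ^q {x} = ^-congʳ x (≡.sym n+1≡q)
      fixed : ∀ x → x ^ (p ℕ.^ v) ≈ x
      fixed x = generated-least F (fixed-isSubfield p p-prime ιp≈0 v (≡.sym n+1≡q))
        (λ x∈A → trans ^q (trans (*-congˡ (lagrange k e x∈A)) (*-identityʳ _))) (generates x)
      ^n≈1 : ∀ x → ¬ x ≈ 0# → x ^ n ≈ 1#
      ^n≈1 x x≉0 = *-cancelʳ x≉0 (begin
        x ^ n * x   ≈⟨ *-comm _ _ ⟩
        x * x ^ n   ≈⟨ ^q ⟨
        x ^ (p ℕ.^ v) ≈⟨ fixed x ⟩
        x           ≈⟨ *-identityˡ x ⟨
        1# * x      ∎)
    singleton : ∀ m → Enumeration setoid A m → (∀ {x y} → A x → A y → x ≈ y) → m ≡ 1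
    singleton zero          e _ = contradiction (proj₁ (Enumeration.exhaust e (power-1 k))) λ ()
    singleton (suc zero)    e _ = ≡.refl
    singleton (suc (suc m)) e all≈ = contradiction
      (Enumeration.distinct e {zero} {suc zero} (all≈ (Enumeration.member e zero) (Enumeration.member e (suc zero)))) λ ()
    by-rank : ∀ r (L : Fin r → ℕ) (d : Fin r → Carrier) → (∀ i → 2 ≤ L i) → (∀ i → ¬ d i ≈ 0#) →
      A U.⊆ Progression +-abelianGroup a L d → Progression +-abelianGroup a L d U.⊆ A → n ∈ 1 ∷ 2 ∷ 4 ∷ []
    by-rank zero    L d 2≤L d≉0 A⊆P P⊆A = here (singleton n e
      (λ x∈A y∈A → trans (proj₂ (A⊆P x∈A)) (sym (proj₂ (A⊆P y∈A)))))
    by-rank (suc r) L d 2≤L d≉0 A⊆P P⊆A =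
      [ (λ n∈ → n∈) , (λ pp → contradiction pp ¬prime-power) ]′
      (order-of-neighbourly p p-prime ιp≈0 (order>0 k e) element distinct (lagrange k e ∘ member) (d zero) (d≉0 zero) λ i →
        [ (λ x+d∈P → inj₁ (lagrange k e (P⊆A x+d∈P))) , (λ x-d∈P → inj₂ (lagrange k e (P⊆A x-d∈P))) ]′
        (progression-neighbour a L d (2≤L zero) (A⊆P (member i))))

  order⇒GAP : ∀ k {n} → Enumeration setoid (PowerSubgroup F k) n → n ∈ 1 ∷ 2 ∷ 4 ∷ [] →
    IsGAP +-abelianGroup (PowerSubgroup F k)
  order⇒GAP k e (here n≡1)                 = order-1⇒GAP k e n≡1
  order⇒GAP k e (there (here n≡2))         = order-2⇒GAP k e n≡2
  order⇒GAP k e (there (there (here n≡4))) = order-4⇒GAP k e n≡4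

open import Data.Nat.Base using (_^_)

theorem1p2 : ∀ {c ℓ} (F : CommutativeRing c ℓ) → IsField F →
    (p f k : ℕ) → Prime p → 1 ≤ f →
    HasCardinality (CommutativeRing.setoid F) (p ^ f) →
    k ∣ p ^ f ∸ 1 →
    ¬ (PowerSubgroup F k ≐ NonZeroElements F) →
    (∀ x → Generated F (PowerSubgroup F k) x) →
    IsGAP (CommutativeRing.+-abelianGroup F) (PowerSubgroup F k) ⇔
    (∃[ n ] HasCardinality (subsetoid (CommutativeRing.setoid F) (PowerSubgroup F k)) n × n ∈ 1 ∷ 2 ∷ 4 ∷ [])
theorem1p2 F isField p f k p-prime _ card _ proper generates = mk⇔
  (λ gap → let n , e = enumerate card (power-resp k) A?
           in n , enumeration⇒cardinality e , GAP⇒order f k p-prime card A? e proper generates gap)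
  (λ (_ , cardA , n∈) → order⇒GAP k (cardinality⇒enumeration cardA) n∈)
  where
  open CommutativeRing F using (_≈_; 0#; setoid; commutativeSemiring; trans; sym)
  open Exp commutativeSemiring using (^-congˡ) renaming (_^_ to _^ᶠ_)
  open Inverse card
  _≟_ : Decidable _≈_
  x ≟ y = Dec.map′ (λ eq → trans (sym (strictlyInverseʳ x)) (trans (from-cong eq) (strictlyInverseʳ y))) to-cong (to x Fin.≟ to y)
  open PowerSubgroups F isField _≟_
  -- A k-th root is searched for among the finitely many field elements.
  A? : U.Decidable (PowerSubgroup F k)
  A? y = Dec.map′
    (λ (i , x≉0 , y≈) → from i , x≉0 , y≈)
    (λ (x , x≉0 , y≈) → to x , (λ eq → x≉0 (trans (sym (strictlyInverseʳ x)) eq))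
                             , trans y≈ (^-congˡ k (sym (strictlyInverseʳ x))))
    (Fin.any? λ i → ¬? (from i ≟ 0#) ×-dec (y ≟ (from i ^ᶠ k)))
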